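{- There is an absolute constant $c^\ast$ such that for every $c_0\ge c^\ast$ there exist constants $a,b>0$ (depending only on $c_0$) such that for infinitely many $n$ there is an $n$-vertex graph $G=(V,E)$ and a set $P\subseteq V\times V$ of demand pairs with $a\,n^{1/2}\le |P|\le b\,n^{1/2}$ such that every pairwise spanner of $(G,P)$ with at most $c_0n$ edges has additive distortion at least $c_0$; i.e., for every subgraph $H\subseteq G$ on the same vertex set with at most $c_0 n$ edges there is a pair $(s,t)\in P$ with $\mathrm{dist}_G(s,t)<\infty$ and $\mathrm{dist}_H(s,t)\ge \mathrm{dist}_G(s,t)+c_0$.
   Context: Graphs are finite, simple, undirected and unweighted; $\mathrm{dist}_G(s,t)$ is the shortest-path distance (number of edges) in $G$, with value $+\infty$ if $s,t$ are disconnected. A pairwise spanner of $(G,P)$ is a subgraph $H\subseteq G$ on the same vertex set, and its additive distortion is the largest value of $\mathrm{dist}_H(s,t)-\mathrm{dist}_G(s,t)$ over demand pairs $(s,t)\in P$. -}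

module Defs where

open import Data.Fin as Fin using (Fin)
open import Data.Fin.Properties as Fin using ()
open import Data.Integer using (+_)
open import Data.List using (List; length; filter; allFin; cartesianProduct)
open import Data.List.Relation.Unary.Unique.Propositional using (Unique)
open import Data.Nat using (ℕ; zero; suc)
import Data.Nat as ℕ
open import Data.Product using (∃; ∃-syntax; _×_; _,_)
open import Data.Rational using (ℚ; _/_; _+_; _*_; _≤_; _<_)
open import Data.Sum using (_⊎_)
open import Data.Unit using (⊤)
open import Function.Bundles using (_⇔_)
open import Level using (0ℓ)
open import Relation.Binary.Core using (Rel)
open import Relation.Binary.Definitions using (Decidable; Symmetric; Irreflexive)
open import Relation.Binary.PropositionalEquality using (_≡_)
open import Relation.Nullary using (¬_)
open import Relation.Nullary.Construct.Add.Supremum using (_⁺; [_]; ⊤⁺)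
open import Relation.Nullary.Decidable using (_×-dec_)

-- Real numbers as two-sided Dedekind cuts: Lower q means q < x and Upper q
-- means x < q.
record ℝ : Set₁ where
  field
    Lower         : ℚ → Set
    Upper         : ℚ → Set
    lowerNonempty : ∃ Lower
    upperNonempty : ∃ Upper
    lowerRounded  : ∀ q → Lower q ⇔ (∃[ r ] (q < r × Lower r))
    upperRounded  : ∀ q → Upper q ⇔ (∃[ r ] (r < q × Upper r))
    disjoint      : ∀ q → ¬ (Lower q × Upper q)
    located       : ∀ q r → q < r → Lower q ⊎ Upper r

fromℕ : ℕ → ℚ
fromℕ m = + m / 1

infix 4 _≤ᴿ_ _≤_·_ _+_≤∞_

_≤ᴿ_ : ℚ → ℝ → Set
q ≤ᴿ x = ∀ r → ℝ.Upper x r → q ≤ r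

-- m ≤ x · n in the reals: since n ≥ 0, x · n is the infimum of the r · n
-- over rationals r > x.
_≤_·_ : ℕ → ℝ → ℕ → Set
m ≤ x · n = ∀ r → ℝ.Upper x r → fromℕ m ≤ r * fromℕ n

-- d + x ≤ e in the extended reals: d + x is the supremum of the d + r over
-- rationals r < x.
_+_≤∞_ : ℕ → ℝ → ℕ ⁺ → Set
d + x ≤∞ ⊤⁺    = ⊤
d + x ≤∞ [ e ] = ∀ r → ℝ.Lower x r → fromℕ d + r ≤ fromℕ e

-- a · √n ≤ m and m ≤ b · √n, squared; this is equivalent to the unsquared
-- inequalities for a, b ≥ 0.
_√_≤_ : ℚ → ℕ → ℕ → Set
a √ n ≤ m = (a * a) * fromℕ n ≤ fromℕ m * fromℕ m

_≤_√_ : ℕ → ℚ → ℕ → Set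
m ≤ b √ n = fromℕ m * fromℕ m ≤ (b * b) * fromℕ n

record Graph (n : ℕ) : Set₁ where
  field
    Adj         : Rel (Fin n) 0ℓ
    adj?        : Decidable Adj
    symmetric   : Symmetric Adj
    irreflexive : Irreflexive _≡_ Adj

-- Each undirected edge is counted once, through its ordering u < v.
edgeCount : ∀ {n} → Graph n → ℕ
edgeCount {n} G =
  length (filter (λ (u , v) → (u Fin.<? v) ×-dec Graph.adj? G u v)
                 (cartesianProduct (allFin n) (allFin n)))

_⊆ᴳ_ : ∀ {n} → Graph n → Graph n → Set
H ⊆ᴳ G = ∀ {u v} → Graph.Adj H u v → Graph.Adj G u v

data Walk {n} (G : Graph n) : Fin n → Fin n → ℕ → Set where
  nil  : ∀ {u} → Walk G u u zero
  cons : ∀ {u v w k} → Graph.Adj G u v → Walk G v w k → Walk G u w (suc k)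

-- Dist G s t d states dist_G(s,t) = d.  A shortest walk is a path, so
-- minimising over walks or over paths gives the same value.
data Dist {n} (G : Graph n) (s t : Fin n) : ℕ ⁺ → Set where
  connected    : ∀ {d} → Walk G s t d → (∀ {k} → Walk G s t k → d ℕ.≤ k) →
                 Dist G s t [ d ]
  disconnected : (∀ {k} → ¬ Walk G s t k) → Dist G s t ⊤⁺

record DemandSet (n : ℕ) : Set where
  field
    pairs  : List (Fin n × Fin n)
    unique : Unique pairs

∣_∣ : ∀ {n} → DemandSet n → ℕ
∣ P ∣ = length (DemandSet.pairs P)

{-# OPTIONS --safe #-}

-- Vertices of an outer grid (x, y) are replaced by gadgets, which are layered
-- graphs in which a typical vertex lies on a number of lines of order K, and which are
-- joined by subdivided links.  A demand pair is joined by a line that crosses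
-- one gadget per column x, always in the same direction a, and moves by the same
-- slope c from column to column.  Each link of slope c has a length convex in c,
-- so a walk that uses a link of another slope loses at least C.  Links of equal
-- slope at the same gadget leave it at positions R apart, and since in a gadget
-- the steps (b, b²) are in convex position, getting from one to another also
-- loses at least C.  Hence a walk that is less than C too long follows the line
-- at every gadget, except that each detour inside a gadget loses a fixed
-- fraction 1/Λ of an edge, so that less than Q = Λ C gadgets are not crossed
-- along the line.  A subgraph of small distortion therefore contains at least
-- half of the edges of the lines, which is more than C n edges.
--
-- The bounds on walks are obtained from potentials that change by at most Λ
-- along each edge.
module Submission where

-- Walks, decidable distances and counting in lists.

module Graphs where
  open import Defs
  open import Data.Fin using (Fin)
  import Data.Fin.Properties as Fin
  open import Data.List using (List; []; _∷_; _++_; length; map; filter; cartesianProduct; allFin)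
  open import Data.List.Properties using (length-++; filter-++; length-map)
  open import Data.List.Membership.Propositional using (_∈_)
  open import Data.List.Membership.Propositional.Properties
    using (∈-∃++; ∈-++⁻; ∈-++⁺ˡ; ∈-++⁺ʳ; ∈-allFin)
  open import Data.List.Relation.Unary.All as All using ()
  open import Data.List.Relation.Unary.AllPairs as AllPairs using ()
  open import Data.List.Relation.Unary.Any using (here; there)
  open import Data.List.Relation.Unary.Unique.Propositional using (Unique)
  open import Data.Nat as ℕ using (ℕ; zero; suc; z≤n; s≤s)
  import Data.Nat.Properties as ℕ
  open import Data.Nat.Induction using (<-rec)
  open import Data.Product using (∃; _×_; _,_)
  open import Data.Sum using (_⊎_; inj₁; inj₂)
  open import Function using (_∘_)
  open import Relation.Binary.PropositionalEquality hiding ([_])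
  open import Relation.Nullary using (Dec; yes; no; contradiction)
  open import Relation.Nullary.Decidable using (map′; _×-dec_; _⊎-dec_; ¬?)
  open import Relation.Nullary.Construct.Add.Supremum using ([_]; ⊤⁺)
  open import Relation.Unary using (Pred; Decidable)
  open import Level using (0ℓ)

  module _ {n} {G : Graph n} where

    infixr 5 _++ʷ_

    _++ʷ_ : ∀ {u v w k l} → Walk G u v k → Walk G v w l → Walk G u w (k ℕ.+ l)
    nil      ++ʷ q = q
    cons e p ++ʷ q = cons e (p ++ʷ q)

    snoc : ∀ {u v w k} → Walk G u v k → Graph.Adj G v w → Walk G u w (suc k)
    snoc nil        e = cons e nil
    snoc (cons f p) e = cons f (snoc p e)

  module Distance {n} (G : Graph n) where
    open Graph G

    -- Reachability through interior vertices from the list only, as in the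
    -- Floyd–Warshall algorithm.
    Reach : List (Fin n) → Fin n → Fin n → Set
    Reach []       u v = u ≡ v ⊎ Adj u v
    Reach (w ∷ ws) u v = Reach ws u v ⊎ (Reach ws u w × Reach ws w v)

    reach? : ∀ ws u v → Dec (Reach ws u v)
    reach? []       u v = (u Fin.≟ v) ⊎-dec adj? u v
    reach? (w ∷ ws) u v = reach? ws u v ⊎-dec (reach? ws u w ×-dec reach? ws w v)

    reach⇒walk : ∀ ws {u v} → Reach ws u v → ∃ (Walk G u v)
    reach⇒walk []       (inj₁ refl)    = 0 , nil
    reach⇒walk []       (inj₂ e)       = 1 , cons e nil
    reach⇒walk (w ∷ ws) (inj₁ r)       = reach⇒walk ws r
    reach⇒walk (w ∷ ws) (inj₂ (r , s)) =
      let k , p = reach⇒walk ws r ; l , q = reach⇒walk ws s in k ℕ.+ l , p ++ʷ q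

    reach-base : ∀ ws {u v} → Reach [] u v → Reach ws u v
    reach-base []       r = r
    reach-base (w ∷ ws) r = inj₁ (reach-base ws r)

    -- When `w` itself is the pivot, the pieces that return to it are dropped. When both parts pass
    -- through another pivot, the loop from that pivot through `w` and back is dropped.
    reach-trans : ∀ {ws u v w} → w ∈ ws → Reach ws u w → Reach ws w v → Reach ws u v
    reach-trans (here refl) r s = inj₂ (to r , from s)
      where
      to : ∀ {ws u w} → Reach (w ∷ ws) u w → Reach ws u w
      to (inj₁ r)       = r
      to (inj₂ (r , _)) = r
      from : ∀ {ws v w} → Reach (w ∷ ws) w v → Reach ws w v
      from (inj₁ r)       = r
      from (inj₂ (_ , r)) = r
    reach-trans (there w∈ws) (inj₁ r)       (inj₁ s)       = inj₁ (reach-trans w∈ws r s)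
    reach-trans (there w∈ws) (inj₁ r)       (inj₂ (s , t)) = inj₂ (reach-trans w∈ws r s , t)
    reach-trans (there w∈ws) (inj₂ (r , s)) (inj₁ t)       = inj₂ (r , reach-trans w∈ws s t)
    reach-trans (there w∈ws) (inj₂ (r , _)) (inj₂ (_ , t)) = inj₂ (r , t)

    walk⇒reach : ∀ {u v k} → Walk G u v k → Reach (allFin n) u v
    walk⇒reach nil        = reach-base (allFin n) (inj₁ refl)
    walk⇒reach (cons {v = v} e p) =
      reach-trans (∈-allFin v) (reach-base (allFin n) (inj₂ e)) (walk⇒reach p)

    walk? : ∀ u v k → Dec (Walk G u v k)
    walk? u v zero    = map′ (λ { refl → nil }) (λ { nil → refl }) (u Fin.≟ v)
    walk? u v (suc k) =
      map′ (λ (_ , e , p) → cons e p) (λ { (cons e p) → _ , e , p })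
           (Fin.any? λ w → adj? u w ×-dec walk? w v k)

    Shortest : Fin n → Fin n → ℕ → Set
    Shortest u v d = Walk G u v d × (∀ {k} → Walk G u v k → d ℕ.≤ k)

    shortest : ∀ {u v} k → Walk G u v k → ∃ (Shortest u v)
    shortest {u} {v} = <-rec (λ k → Walk G u v k → ∃ (Shortest u v)) step
      where
      step : ∀ k → (∀ {j} → j ℕ.< k → Walk G u v j → ∃ (Shortest u v)) →
             Walk G u v k → ∃ (Shortest u v)
      step k rec p with ℕ.anyUpTo? (walk? u v) k
      ... | yes (j , j<k , q) = rec j<k q
      ... | no  minimal       =
        k , p , λ {j} q → ℕ.≮⇒≥ λ j<k → minimal (j , j<k , q)

    -- The theorem asks for the value of the distance in the spanner, so connectedness has to be
    -- decided. `walk?` does this for one length, `Reach` for all lengths at once.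
    distance : ∀ u v → ∃ (Dist G u v)
    distance u v with reach? (allFin n) u v
    ... | no  ¬r = ⊤⁺ , disconnected (¬r ∘ walk⇒reach)
    ... | yes r  =
      let k , p = reach⇒walk (allFin n) r ; d , q , min = shortest k p in [ d ] , connected q min

  module _ {A B : Set} where

    -- Induction removes `f x` from `ys`; injectivity keeps the remaining images in what is left.
    length-injection : ∀ {xs : List A} {ys : List B} (f : A → B) → Unique xs →
      (∀ {x} → x ∈ xs → f x ∈ ys) →
      (∀ {x y} → x ∈ xs → y ∈ xs → f x ≡ f y → x ≡ y) →
      length xs ℕ.≤ length ys
    length-injection {[]}     f _ _ _ = z≤n
    length-injection {x ∷ xs} {ys} f (x∉xs AllPairs.∷ uniq) into inj
      with as , bs , refl ← ∈-∃++ (into (here refl)) =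
      subst (suc (length xs) ℕ.≤_)
        (trans (cong suc (length-++ as)) (trans (sym (ℕ.+-suc (length as) (length bs)))
          (sym (length-++ as))))
        (s≤s (length-injection {xs} {as ++ bs} f uniq into′ λ p q → inj (there p) (there q)))
      where
      into′ : ∀ {y} → y ∈ xs → f y ∈ as ++ bs
      into′ y∈xs with ∈-++⁻ as (into (there y∈xs))
      ... | inj₁ p           = ∈-++⁺ˡ p
      ... | inj₂ (there p)   = ∈-++⁺ʳ as p
      ... | inj₂ (here fy≡fx) =
        contradiction (inj (here refl) (there y∈xs) (sym fy≡fx)) (All.lookup x∉xs y∈xs)

  length-cartesianProduct : {A B : Set} (xs : List A) (ys : List B) →
    length (cartesianProduct xs ys) ≡ length xs ℕ.* length ys
  length-cartesianProduct []       ys = refl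
  length-cartesianProduct (x ∷ xs) ys =
    trans (length-++ (map (x ,_) ys))
          (cong₂ ℕ._+_ (length-map (x ,_) ys) (length-cartesianProduct xs ys))

  module _ {A : Set} {P : Pred A 0ℓ} (P? : Decidable P) where

    length-filter-∁ : ∀ xs → length (filter P? xs) ℕ.+ length (filter (¬? ∘ P?) xs) ≡ length xs
    length-filter-∁ []       = refl
    length-filter-∁ (x ∷ xs) with P? x
    ... | yes _ = cong suc (length-filter-∁ xs)
    ... | no  _ = trans (ℕ.+-suc _ _) (cong suc (length-filter-∁ xs))

  module _ {A B : Set} {P : Pred (A × B) 0ℓ} (P? : Decidable P) where

    length-filter-map : ∀ x ys →
      length (filter P? (map (x ,_) ys)) ≡ length (filter (λ y → P? (x , y)) ys)
    length-filter-map x []       = refl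
    length-filter-map x (y ∷ ys) with P? (x , y)
    ... | yes _ = cong suc (length-filter-map x ys)
    ... | no  _ = length-filter-map x ys

    length-filter-cartesianProduct : ∀ {m} xs ys →
      (∀ {x} → x ∈ xs → m ℕ.≤ length (filter (λ y → P? (x , y)) ys)) →
      length xs ℕ.* m ℕ.≤ length (filter P? (cartesianProduct xs ys))
    length-filter-cartesianProduct []       ys h = z≤n
    length-filter-cartesianProduct {m} (x ∷ xs) ys h = begin
      m ℕ.+ length xs ℕ.* m
        ≤⟨ ℕ.+-mono-≤ (h (here refl)) (length-filter-cartesianProduct xs ys (h ∘ there)) ⟩
      length (filter (λ y → P? (x , y)) ys) ℕ.+ length (filter P? (cartesianProduct xs ys))
        ≡⟨ cong (ℕ._+ length (filter P? (cartesianProduct xs ys))) (length-filter-map x ys) ⟨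
      length (filter P? (map (x ,_) ys)) ℕ.+ length (filter P? (cartesianProduct xs ys))
        ≡⟨ length-++ (filter P? (map (x ,_) ys)) ⟨
      length (filter P? (map (x ,_) ys) ++ filter P? (cartesianProduct xs ys))
        ≡⟨ cong length (filter-++ P? (map (x ,_) ys) _) ⟨
      length (filter P? (map (x ,_) ys ++ cartesianProduct xs ys)) ∎
      where open ℕ.≤-Reasoning

-- The level function, which measures the excess inside a gadget.

module Level where
  open import Data.Integer hiding (suc)
  open import Data.Integer.Properties
  open import Data.Integer.Tactic.RingSolver using (solve-∀)
  open import Data.Nat as ℕ using (ℕ; zero; suc; z≤n)
  import Data.Nat.Properties as ℕ
  open import Data.Sum using (_⊎_; inj₁; inj₂)
  open import Relation.Binary.PropositionalEquality

  -- The slack of the goal is equated with known slacks, which leaves a ring identity for the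
  -- solver.
  ≤-by : ∀ {i j x y} → x ≤ y → j - i ≡ y - x → i ≤ j
  ≤-by x≤y eq = 0≤i-j⇒j≤i (subst (0ℤ ≤_) (sym eq) (i≤j⇒0≤j-i x≤y))

  ≤-by₂ : ∀ {i j x y u v} → x ≤ y → u ≤ v → j - i ≡ (y - x) + (v - u) → i ≤ j
  ≤-by₂ x≤y u≤v eq =
    0≤i-j⇒j≤i (subst (0ℤ ≤_) (sym eq) (+-mono-≤ (i≤j⇒0≤j-i x≤y) (i≤j⇒0≤j-i u≤v)))

  ≤-by₃ : ∀ {i j x y u v p q} → x ≤ y → u ≤ v → p ≤ q →
          j - i ≡ (y - x) + (v - u) + (q - p) → i ≤ j
  ≤-by₃ x≤y u≤v p≤q eq =
    0≤i-j⇒j≤i (subst (0ℤ ≤_) (sym eq)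
      (+-mono-≤ (+-mono-≤ (i≤j⇒0≤j-i x≤y) (i≤j⇒0≤j-i u≤v)) (i≤j⇒0≤j-i p≤q)))

  clamp : ℕ → ℤ → ℤ
  clamp Q v = 0ℤ ⊔ (v ⊓ + Q)

  module _ {Q : ℕ} where

    clamp-mono : ∀ {v w} → v ≤ w → clamp Q v ≤ clamp Q w
    clamp-mono v≤w = ⊔-monoʳ-≤ 0ℤ (⊓-monoˡ-≤ (+ Q) v≤w)

    0≤clamp : ∀ v → 0ℤ ≤ clamp Q v
    0≤clamp v = i≤i⊔j 0ℤ _

    clamp≤ : ∀ v → clamp Q v ≤ + Q
    clamp≤ v = ⊔-lub (+≤+ z≤n) (i⊓j≤j v (+ Q))

    clamp-fix : ∀ {h} → h ℕ.≤ Q → clamp Q (+ h) ≡ + h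
    clamp-fix h≤Q = cong (0ℤ ⊔_) (i≤j⇒i⊓j≡i (+≤+ h≤Q))

    clamp-low : ∀ {v} → v ≤ 0ℤ → clamp Q v ≡ 0ℤ
    clamp-low {v} v≤0 = i≥j⇒i⊔j≡i (≤-trans (i⊓j≤i v (+ Q)) v≤0)

    clamp-high : ∀ {v} → + Q ≤ v → clamp Q v ≡ + Q
    clamp-high Q≤v = cong (0ℤ ⊔_) (i≥j⇒i⊓j≡j Q≤v)

    clamp-lipschitz : ∀ {v} w k → v ≤ w + + k → clamp Q v ≤ clamp Q w + + k
    clamp-lipschitz {v} w k v≤w+k with ≤-total w 0ℤ | ≤-total w (+ Q)
    ... | inj₁ w≤0 | _ = subst (λ c → clamp Q v ≤ c + + k) (sym (clamp-low w≤0))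
      (⊔-lub (+≤+ z≤n) (≤-trans (i⊓j≤i v (+ Q)) (≤-trans v≤w+k (+-monoˡ-≤ (+ k) w≤0))))
    ... | inj₂ _   | inj₂ Q≤w = subst (λ c → clamp Q v ≤ c + + k) (sym (clamp-high Q≤w))
      (≤-trans (clamp≤ v) (i≤i+j (+ Q) (+ k)))
    ... | inj₂ 0≤w | inj₁ w≤Q = subst (λ c → clamp Q v ≤ c + + k)
      (sym (trans (cong (0ℤ ⊔_) (i≤j⇒i⊓j≡i w≤Q)) (i≤j⇒i⊔j≡j 0≤w)))
      (⊔-lub (+-mono-≤ 0≤w (+≤+ {n = k} z≤n)) (≤-trans (i⊓j≤i v (+ Q)) v≤w+k))

    clamp-below : ∀ {v h} → v ≤ + h → clamp Q v ≤ + h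
    clamp-below {v} v≤h = ⊔-lub (+≤+ z≤n) (≤-trans (i⊓j≤i v (+ Q)) v≤h)

  -- A step that deviates by `d` costs d² twice: one d² covers the change of at most |d| in the
  -- first term, the other is a true loss. The term in `ζ` removes the dependence on `b` for large
  -- |ζ|, and the clamp does so for large |o|.
  level : ℕ → ℕ → ℤ → ℤ → ℤ
  level Q b o ζ = clamp Q (+ (b ℕ.∸ ∣ ζ ∣) - (o + o))

  ∸-lipschitz : ∀ b {m m′ k} → m′ ℕ.≤ m ℕ.+ k → b ℕ.∸ m ℕ.≤ b ℕ.∸ m′ ℕ.+ k
  ∸-lipschitz b {m} {m′} {k} m′≤m+k = ℕ.m≤n+o⇒m∸n≤o b m (begin
    b                             ≤⟨ ℕ.m≤n+m∸n b m′ ⟩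
    m′ ℕ.+ (b ℕ.∸ m′)             ≤⟨ ℕ.+-monoˡ-≤ (b ℕ.∸ m′) m′≤m+k ⟩
    m ℕ.+ k ℕ.+ (b ℕ.∸ m′)        ≡⟨ ℕ.+-assoc m k _ ⟩
    m ℕ.+ (k ℕ.+ (b ℕ.∸ m′))      ≡⟨ cong (m ℕ.+_) (ℕ.+-comm k _) ⟩
    m ℕ.+ (b ℕ.∸ m′ ℕ.+ k)        ∎)
    where open ℕ.≤-Reasoning

  ∣i∣²≡i*i : ∀ i → + (∣ i ∣ ℕ.* ∣ i ∣) ≡ i * i
  ∣i∣²≡i*i (+ n)    = pos-* n n
  ∣i∣²≡i*i -[1+ n ] = refl

  ∣i∣≤i*i : ∀ i → + ∣ i ∣ ≤ i * i
  ∣i∣≤i*i i = subst (+ ∣ i ∣ ≤_) (∣i∣²≡i*i i) (+≤+ (m≤m*m ∣ i ∣))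
    where
    m≤m*m : ∀ m → m ℕ.≤ m ℕ.* m
    m≤m*m zero    = z≤n
    m≤m*m (suc m) = ℕ.m≤m*n (suc m) (suc m)

  0≤i*i : ∀ i → 0ℤ ≤ i * i
  0≤i*i i = subst (0ℤ ≤_) (∣i∣²≡i*i i) (+≤+ z≤n)

  1≤i*i : ∀ i → i ≢ 0ℤ → 1ℤ ≤ i * i
  1≤i*i i i≢0 = ≤-trans (+≤+ (ℕ.n≢0⇒n>0 λ ∣i∣≡0 → i≢0 (∣i∣≡0⇒i≡0 ∣i∣≡0))) (∣i∣≤i*i i)

  module _ (Q : ℕ) where

    level-forward : ∀ b o ζ d → level Q b (o + d * d) (ζ + d) ≤ level Q b o ζ
    level-forward b o ζ d = clamp-mono
      (≤-by₃ {x = + (b ℕ.∸ ∣ ζ + d ∣)} {y = + (b ℕ.∸ ∣ ζ ∣) + + ∣ d ∣}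
        (+≤+ (∸-lipschitz b {∣ ζ + d ∣} {∣ ζ ∣} {∣ d ∣}
          (subst (λ ξ → ∣ ξ ∣ ℕ.≤ ∣ ζ + d ∣ ℕ.+ ∣ d ∣) (lemma ζ d) (∣i-j∣≤∣i∣+∣j∣ (ζ + d) d))))
        (∣i∣≤i*i d) (0≤i*i d)
        (identity (+ (b ℕ.∸ ∣ ζ + d ∣)) (+ (b ℕ.∸ ∣ ζ ∣)) (+ ∣ d ∣) o (d * d)))
      where
      lemma : ∀ ζ d → (ζ + d) - d ≡ ζ
      lemma = solve-∀
      identity : ∀ h′ h n o e → (h - (o + o)) - (h′ - ((o + e) + (o + e))) ≡
                 ((h + n) - h′) + (e - n) + (e - 0ℤ)
      identity = solve-∀

    level-backward : ∀ b o ζ d →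
      level Q b o ζ ≤ level Q b (o + d * d) (ζ + d) + + (∣ d ∣ ℕ.+ (∣ d ∣ ℕ.* ∣ d ∣ ℕ.+ ∣ d ∣ ℕ.* ∣ d ∣))
    level-backward b o ζ d = clamp-lipschitz (+ (b ℕ.∸ ∣ ζ + d ∣) - ((o + d * d) + (o + d * d)))
      (∣ d ∣ ℕ.+ (∣ d ∣ ℕ.* ∣ d ∣ ℕ.+ ∣ d ∣ ℕ.* ∣ d ∣))
      (≤-by {x = + (b ℕ.∸ ∣ ζ ∣)} {y = + (b ℕ.∸ ∣ ζ + d ∣) + + ∣ d ∣}
        (+≤+ (∸-lipschitz b (∣i+j∣≤∣i∣+∣j∣ ζ d)))
        (trans (cong (λ e → ((+ (b ℕ.∸ ∣ ζ + d ∣) - ((o + d * d) + (o + d * d))) + (+ ∣ d ∣ + (e + e)))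
                            - (+ (b ℕ.∸ ∣ ζ ∣) - (o + o))) (∣i∣²≡i*i d))
          (identity (+ (b ℕ.∸ ∣ ζ + d ∣)) (+ (b ℕ.∸ ∣ ζ ∣)) (+ ∣ d ∣) o (d * d))))
      where
      identity : ∀ h′ h n o e → ((h′ - ((o + e) + (o + e))) + (n + (e + e))) - (h - (o + o)) ≡
                 (h′ + n) - h
      identity = solve-∀

    level-origin : ∀ {b} → b ℕ.≤ Q → level Q b 0ℤ 0ℤ ≡ + b
    level-origin {b} b≤Q = trans (cong (clamp Q) (+-identityʳ (+ b))) (clamp-fix b≤Q)

    -- This serves walks that leave the line before the missing edge: `b` may already become `b + 1`
    -- there, but the loss from d² ≥ 1 makes up for it.
    level-exit : ∀ {b b′} d → b′ ℕ.≤ suc b → d ≢ 0ℤ → level Q b′ (0ℤ + d * d) (0ℤ + d) ≤ + b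
    level-exit {b} {b′} d b′≤1+b d≢0 = clamp-below
      (≤-by₃ {x = + (b′ ℕ.∸ ∣ 0ℤ + d ∣)} {y = 1ℤ + + b}
        (+≤+ (ℕ.≤-trans (ℕ.m∸n≤m b′ ∣ 0ℤ + d ∣) b′≤1+b)) (1≤i*i d d≢0) (0≤i*i d)
        (identity (+ (b′ ℕ.∸ ∣ 0ℤ + d ∣)) (+ b) (d * d)))
      where
      identity : ∀ h b e → b - (h - ((0ℤ + e) + (0ℤ + e))) ≡ ((1ℤ + b) - h) + (e - 1ℤ) + (e - 0ℤ)
      identity = solve-∀

    Far : ℤ → ℤ → Set
    Far o ζ = Q ℕ.≤ ∣ o ∣ ⊎ Q ℕ.≤ ∣ ζ ∣

    -- Large |ζ| cancels `b` in the truncated subtraction, large positive `o` clamps to 0, and large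
    -- negative `o` clamps to `Q`.
    level-far : ∀ {b o ζ} → b ℕ.≤ Q → Far o ζ → level Q b o ζ ≡ level Q 0 o ζ
    level-far {b} {o} {ζ} b≤Q (inj₂ Q≤ζ) = cong (λ h → clamp Q (+ h - (o + o)))
      (trans (ℕ.m≤n⇒m∸n≡0 (ℕ.≤-trans b≤Q Q≤ζ)) (sym (ℕ.0∸n≡0 ∣ ζ ∣)))
    level-far {b} {+ n} {ζ} b≤Q (inj₁ Q≤n) = trans (low b b≤Q) (sym (low 0 z≤n))
      where
      low : ∀ b → b ℕ.≤ Q → level Q b (+ n) ζ ≡ 0ℤ
      low b b≤Q = clamp-low (≤-by₂ {x = + (b ℕ.∸ ∣ ζ ∣)} {y = + n}
        (+≤+ (ℕ.≤-trans (ℕ.m∸n≤m b ∣ ζ ∣) (ℕ.≤-trans b≤Q Q≤n))) (+≤+ {n = n} z≤n)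
        (identity (+ (b ℕ.∸ ∣ ζ ∣)) (+ n)))
        where
        identity : ∀ h n → 0ℤ - (h - (n + n)) ≡ (n - h) + (n - 0ℤ)
        identity = solve-∀
    level-far {b} { -[1+ n ]} {ζ} b≤Q (inj₁ Q≤n) = trans (high b) (sym (high 0))
      where
      high : ∀ b → level Q b -[1+ n ] ζ ≡ + Q
      high b = clamp-high {v = + (b ℕ.∸ ∣ ζ ∣) - (-[1+ n ] + -[1+ n ])} (≤-by₃ {x = + Q} {y = + suc n} (+≤+ Q≤n)
        (+≤+ {n = suc n} z≤n) (+≤+ {n = b ℕ.∸ ∣ ζ ∣} z≤n)
        (identity (+ (b ℕ.∸ ∣ ζ ∣)) (+ Q) (+ suc n)))
        where
        identity : ∀ h q n → (h - ((- n) + (- n))) - q ≡ (n - q) + (n - 0ℤ) + (h - 0ℤ)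
        identity = solve-∀

-- The potential belonging to a fixed line.

module Potential where
  open Level
  open import Data.Bool using (if_then_else_)
  open import Data.Integer hiding (suc)
  open import Data.Integer.Properties
  open import Data.Integer.Tactic.RingSolver using (solve-∀)
  open import Data.Nat as ℕ using (ℕ; suc; z≤n; s≤s)
  import Data.Nat.Properties as ℕ
  open import Data.Nat.Tactic.RingSolver using () renaming (solve-∀ to ℕ-solve-∀)
  open import Data.Product using (_×_; _,_; proj₁; proj₂)
  open import Data.Sum using (_⊎_; inj₁; inj₂)
  open import Relation.Binary.PropositionalEquality
  open import Relation.Nullary using (contradiction; Dec; yes; no; does)
  open import Relation.Nullary.Decidable using (_×-dec_)

  line-step : ∀ p t c → p ℕ.+ t ℕ.* c ℕ.+ c ≡ p ℕ.+ suc t ℕ.* c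
  line-step p t c = trans (ℕ.+-assoc p (t ℕ.* c) c) (cong (p ℕ.+_) (ℕ.+-comm (t ℕ.* c) c))

  Close : ℤ → ℤ → ℤ → Set
  Close k u v = v ≤ u + k × u ≤ v + k

  -- κ γ is the number of interior vertices of a link of slope γ.  It is convex
  -- in γ, and this is what makes a line of constant slope the only geodesic.
  module Parameters (K M ℓ s : ℕ) where

    -- `Λ + Λ` bounds the change 1 + |d| + 2d² of the excess against the direction of a gadget step,
    -- where |d| < `K`. An excess of `Q` is worth `s` additional edges.
    Λ Q : ℕ
    Λ = K ℕ.* K ℕ.+ K
    Q = Λ ℕ.* s

    κ : ℕ → ℕ
    κ γ = s ℕ.* (M ℕ.* M ℕ.+ 1) ℕ.+ s ℕ.* (γ ℕ.* γ)

    period : ℕ → ℕ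
    period γ = ℓ ℕ.+ suc (κ γ)

  module _ (K M ℓ s : ℕ) where
    open Parameters K M ℓ s

    -- `β x` is meant to count, up to `Q`, the columns before `x` in which the subgraph lacks an
    -- edge of the line, and `τ x` is the layer of such an edge in column `x`. Both stay arbitrary,
    -- so that `β` = 0 also yields distances in the full graph.
    module Line (1≤s : 1 ℕ.≤ s) (y₀ γ a p₁ p₂ : ℕ) (γ<M : γ ℕ.< M) (a<K : a ℕ.< K)
      (τ β : ℕ → ℕ) (τ<ℓ : ∀ x → τ x ℕ.< ℓ) (β≤Q : ∀ x → β x ℕ.≤ Q)
      (β-mono : ∀ x → β x ℕ.≤ β (suc x)) (β-step : ∀ x → β (suc x) ℕ.≤ suc (β x)) where

      1≤Q : 1 ℕ.≤ Q
      1≤Q = ℕ.*-mono-≤ {1} {Λ} {1} {s}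
        (ℕ.≤-trans (ℕ.≤-trans (s≤s z≤n) a<K) (ℕ.m≤n+m K (K ℕ.* K))) 1≤s

      A G S L : ℤ
      A = + a
      G = + γ
      S = + s
      L = + Λ

      +Q≡ : + Q ≡ L * S
      +Q≡ = pos-* Λ s

      +κ≡ : ∀ g → + suc (κ g) ≡ 1ℤ + (S * (+ M * + M + 1ℤ) + S * (+ g * + g))
      +κ≡ g = cong (λ k → 1ℤ + k) (cong₂ _+_
        (trans (pos-* s (M ℕ.* M ℕ.+ 1)) (cong (λ m → S * (m + 1ℤ)) (pos-* M M)))
        (trans (pos-* s (g ℕ.* g)) (cong (S *_) (pos-* g g))))

      -- The position along the line, extended to other rows with the factor 2sγ, the derivative at
      -- `γ` of the link length as a function of the slope.
      base : ℕ → ℕ → ℕ → ℤ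
      base t x y = + x * (+ ℓ + + suc (κ γ)) + (+ 2 * S * G) * (+ y - (+ y₀ + G * + x)) + + t

      -- Deviation from the line: a step b of a gadget adds d = b − a to ζ and d² to o.
      ζ : ℕ → ℕ → ℤ
      ζ t z₁ = + z₁ - (+ p₁ + + t * A)

      o : ℕ → ℕ → ℕ → ℤ
      o t z₁ z₂ = (+ z₂ - (+ p₂ + + t * (A * A))) - + 2 * A * ζ t z₁

      Low : ℕ → ℕ → ℕ → ℕ → Set
      Low t x z₁ z₂ = t ℕ.≤ τ x × z₁ ≡ p₁ ℕ.+ t ℕ.* a × z₂ ≡ p₂ ℕ.+ t ℕ.* (a ℕ.* a)

      OnLine : ℕ → ℕ → Set
      OnLine x y = y ≡ y₀ ℕ.+ γ ℕ.* x

      abstract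
        low? : ∀ t x z₁ z₂ → Dec (Low t x z₁ z₂)
        low? t x z₁ z₂ =
          (t ℕ.≤? τ x) ×-dec (z₁ ℕ.≟ p₁ ℕ.+ t ℕ.* a) ×-dec (z₂ ℕ.≟ p₂ ℕ.+ t ℕ.* (a ℕ.* a))

        onLine? : ∀ x y → Dec (OnLine x y)
        onLine? x y = y ℕ.≟ y₀ ℕ.+ γ ℕ.* x

      -- A lower bound for Λ times the excess length of a walk that has got here.  On
      -- the line it rises from β x to β (x + 1) between the layers τ x and τ x + 1,
      -- where the edge of the line is missing; off the line it decreases with o,
      -- and at distance Q it no longer depends on x.
      gadgetExcess : ℕ → ℕ → ℕ → ℕ → ℤ
      gadgetExcess t x z₁ z₂ =
        if does (low? t x z₁ z₂) then + β x else level Q (β (suc x)) (o t z₁ z₂) (ζ t z₁)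

      excess : ℕ → ℕ → ℕ → ℕ → ℕ → ℤ
      excess t x y z₁ z₂ = if does (onLine? x y) then gadgetExcess t x z₁ z₂ else 0ℤ

      potential : ℕ → ℕ → ℕ → ℕ → ℕ → ℤ
      potential t x y z₁ z₂ = L * base t x y + excess t x y z₁ z₂

      0≤gadgetExcess : ∀ t x z₁ z₂ → 0ℤ ≤ gadgetExcess t x z₁ z₂
      0≤gadgetExcess t x z₁ z₂ with low? t x z₁ z₂
      ... | yes _ = +≤+ z≤n
      ... | no  _ = 0≤clamp _

      gadgetExcess≤Q : ∀ t x z₁ z₂ → gadgetExcess t x z₁ z₂ ≤ + Q
      gadgetExcess≤Q t x z₁ z₂ with low? t x z₁ z₂
      ... | yes _ = +≤+ (β≤Q x)
      ... | no  _ = clamp≤ (+ (β (suc x) ℕ.∸ ∣ ζ t z₁ ∣) - (o t z₁ z₂ + o t z₁ z₂))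

      0≤excess : ∀ t x y z₁ z₂ → 0ℤ ≤ excess t x y z₁ z₂
      0≤excess t x y z₁ z₂ with onLine? x y
      ... | yes _ = 0≤gadgetExcess t x z₁ z₂
      ... | no  _ = +≤+ z≤n

      excess≤Q : ∀ t x y z₁ z₂ → excess t x y z₁ z₂ ≤ + Q
      excess≤Q t x y z₁ z₂ with onLine? x y
      ... | yes _ = gadgetExcess≤Q t x z₁ z₂
      ... | no  _ = +≤+ z≤n

      ζ-line : ∀ t p → ζ t (p ℕ.+ t ℕ.* a) ≡ + p - + p₁
      ζ-line t p = trans (cong (λ m → (+ p + m) - (+ p₁ + + t * A)) (pos-* t a))
                         (identity (+ p) (+ p₁) (+ t * A))
        where
        identity : ∀ p q m → (p + m) - (q + m) ≡ p - q
        identity = solve-∀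

      o-line : ∀ t p q → o t (p ℕ.+ t ℕ.* a) (q ℕ.+ t ℕ.* (a ℕ.* a)) ≡
               (+ q - + p₂) - + 2 * A * (+ p - + p₁)
      o-line t p q = cong₂ (λ u v → u - + 2 * A * v)
        (trans (cong (λ m → (+ q + m) - (+ p₂ + + t * (A * A)))
                 (trans (pos-* t (a ℕ.* a)) (cong (+ t *_) (pos-* a a))))
               (identity (+ q) (+ p₂) (+ t * (A * A))))
        (ζ-line t p)
        where
        identity : ∀ p q m → (p + m) - (q + m) ≡ p - q
        identity = solve-∀

      ζ-here : ∀ t → ζ t (p₁ ℕ.+ t ℕ.* a) ≡ 0ℤ
      ζ-here t = trans (ζ-line t p₁) (+-inverseʳ (+ p₁))

      o-here : ∀ t → o t (p₁ ℕ.+ t ℕ.* a) (p₂ ℕ.+ t ℕ.* (a ℕ.* a)) ≡ 0ℤ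
      o-here t = trans (o-line t p₁ p₂) (identity (+ p₁) (+ p₂) A)
        where
        identity : ∀ p q a → (q - q) - + 2 * a * (p - p) ≡ 0ℤ
        identity = solve-∀

      level-here : ∀ {b} t → b ℕ.≤ Q →
        level Q b (o t (p₁ ℕ.+ t ℕ.* a) (p₂ ℕ.+ t ℕ.* (a ℕ.* a))) (ζ t (p₁ ℕ.+ t ℕ.* a)) ≡ + b
      level-here {b} t b≤Q = trans (cong₂ (level Q b) (o-here t) (ζ-here t)) (level-origin Q b≤Q)

      -- The two branches of `gadgetExcess` differ only by the jump of `β`: on the line `level`
      -- equals `β (suc x)`, which is at least `β x` and at most one more. `level≤1+gadgetExcess` is
      -- the other half.
      gadgetExcess≤level : ∀ t x z₁ z₂ →
        gadgetExcess t x z₁ z₂ ≤ level Q (β (suc x)) (o t z₁ z₂) (ζ t z₁)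
      gadgetExcess≤level t x z₁ z₂ with low? t x z₁ z₂
      ... | yes (_ , refl , refl) =
        subst (+ β x ≤_) (sym (level-here t (β≤Q (suc x)))) (+≤+ (β-mono x))
      ... | no  _                 = ≤-refl

      level≤1+gadgetExcess : ∀ t x z₁ z₂ →
        level Q (β (suc x)) (o t z₁ z₂) (ζ t z₁) ≤ 1ℤ + gadgetExcess t x z₁ z₂
      level≤1+gadgetExcess t x z₁ z₂ with low? t x z₁ z₂
      ... | yes (_ , refl , refl) =
        subst (_≤ 1ℤ + + β x) (sym (level-here t (β≤Q (suc x)))) (+≤+ (β-step x))
      ... | no  _                 = i≤j+i (level Q (β (suc x)) (o t z₁ z₂) (ζ t z₁)) 1ℤ

      gadgetExcess-out : ∀ x →
        gadgetExcess ℓ x (p₁ ℕ.+ ℓ ℕ.* a) (p₂ ℕ.+ ℓ ℕ.* (a ℕ.* a)) ≡ + β (suc x)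
      gadgetExcess-out x with low? ℓ x (p₁ ℕ.+ ℓ ℕ.* a) (p₂ ℕ.+ ℓ ℕ.* (a ℕ.* a))
      ... | yes (ℓ≤τ , _) = contradiction (τ<ℓ x) (ℕ.≤⇒≯ ℓ≤τ)
      ... | no  _         = level-here ℓ (β≤Q (suc x))

      gadgetExcess-in : ∀ x → gadgetExcess 0 x p₁ p₂ ≡ + β x
      gadgetExcess-in x with low? 0 x p₁ p₂
      ... | yes _   = refl
      ... | no  ¬low = contradiction (z≤n , sym (ℕ.+-identityʳ p₁) , sym (ℕ.+-identityʳ p₂)) ¬low

      gadgetExcess-far : ∀ t x z₁ z₂ → Far Q (o t z₁ z₂) (ζ t z₁) →
        gadgetExcess t x z₁ z₂ ≡ level Q 0 (o t z₁ z₂) (ζ t z₁)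
      gadgetExcess-far t x z₁ z₂ far with low? t x z₁ z₂
      ... | no  _ = level-far Q {o = o t z₁ z₂} {ζ t z₁} (β≤Q (suc x)) far
      ... | yes (_ , refl , refl) with far
      ...   | inj₁ Q≤o = contradiction (subst (λ i → Q ℕ.≤ ∣ i ∣) (o-here t) Q≤o) (ℕ.<⇒≱ 1≤Q)
      ...   | inj₂ Q≤ζ = contradiction (subst (λ i → Q ℕ.≤ ∣ i ∣) (ζ-here t) Q≤ζ) (ℕ.<⇒≱ 1≤Q)

      Marked : ℕ → ℕ → ℕ → ℕ → ℕ → Set
      Marked t x y z₁ z₂ =
        t ≡ τ x × OnLine x y × z₁ ≡ p₁ ℕ.+ t ℕ.* a × z₂ ≡ p₂ ℕ.+ t ℕ.* (a ℕ.* a)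

      ζ-step : ∀ t z₁ b → ζ (suc t) (z₁ ℕ.+ b) ≡ ζ t z₁ + (+ b - A)
      ζ-step t z₁ b = identity (+ z₁) (+ p₁) (+ t) A (+ b)
        where
        identity : ∀ z p t a b → (z + b) - (p + (1ℤ + t) * a) ≡ (z - (p + t * a)) + (b - a)
        identity = solve-∀

      -- With d = b - a this is b² = a² + 2ad + d²: `o` is the second deviation corrected by the
      -- tangent to the parabola at `a`. Here the convex position of the steps enters.
      o-step : ∀ t z₁ z₂ b →
        o (suc t) (z₁ ℕ.+ b) (z₂ ℕ.+ b ℕ.* b) ≡ o t z₁ z₂ + (+ b - A) * (+ b - A)
      o-step t z₁ z₂ b = trans
        (cong (λ e → ((+ z₂ + e) - (+ p₂ + + suc t * (A * A))) - + 2 * A * ζ (suc t) (z₁ ℕ.+ b))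
              (pos-* b b))
        (identity (+ z₁) (+ z₂) (+ p₁) (+ p₂) (+ t) A (+ b))
        where
        identity : ∀ z z′ p q t a b →
          ((z′ + b * b) - (q + (1ℤ + t) * (a * a))) - + 2 * a * ((z + b) - (p + (1ℤ + t) * a)) ≡
          ((z′ - (q + t * (a * a))) - + 2 * a * (z - (p + t * a))) + (b - a) * (b - a)
        identity = solve-∀

      level-step : ∀ h t z₁ z₂ b →
        level Q h (o (suc t) (z₁ ℕ.+ b) (z₂ ℕ.+ b ℕ.* b)) (ζ (suc t) (z₁ ℕ.+ b)) ≡
        level Q h (o t z₁ z₂ + (+ b - A) * (+ b - A)) (ζ t z₁ + (+ b - A))
      level-step h t z₁ z₂ b = cong₂ (level Q h) (o-step t z₁ z₂ b) (ζ-step t z₁ b)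

      -- Outside `Low` the level does not increase, and a sideways step out of `Low` is
      -- `level-exit`. A step along the line keeps `β x`, except from layer `τ x`, where the premise
      -- excludes a jump.
      gadget-forward : ∀ t x z₁ z₂ b →
        (t ≡ τ x → z₁ ≡ p₁ ℕ.+ t ℕ.* a → z₂ ≡ p₂ ℕ.+ t ℕ.* (a ℕ.* a) → b ≡ a → β (suc x) ≡ β x) →
        gadgetExcess (suc t) x (z₁ ℕ.+ b) (z₂ ℕ.+ b ℕ.* b) ≤ gadgetExcess t x z₁ z₂
      gadget-forward t x z₁ z₂ b unmarked with low? t x z₁ z₂
      ... | no  _ = ≤-trans (gadgetExcess≤level (suc t) x (z₁ ℕ.+ b) (z₂ ℕ.+ b ℕ.* b))
        (subst (_≤ level Q (β (suc x)) (o t z₁ z₂) (ζ t z₁))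
          (sym (level-step (β (suc x)) t z₁ z₂ b))
          (level-forward Q (β (suc x)) (o t z₁ z₂) (ζ t z₁) (+ b - A)))
      ... | yes (t≤τ , refl , refl) with b ℕ.≟ a
      ...   | no b≢a = ≤-trans (gadgetExcess≤level (suc t) x (z₁ ℕ.+ b) (z₂ ℕ.+ b ℕ.* b))
        (subst (_≤ + β x)
          (sym (trans (level-step (β (suc x)) t z₁ z₂ b)
            (cong₂ (λ u v → level Q (β (suc x)) (u + (+ b - A) * (+ b - A)) (v + (+ b - A)))
                   (o-here t) (ζ-here t))))
          (level-exit Q (+ b - A) (β-step x) λ b-a≡0 → b≢a (+-injective (i-j≡0⇒i≡j (+ b) A b-a≡0))))
      ...   | yes refl with low? (suc t) x (p₁ ℕ.+ t ℕ.* a ℕ.+ a) (p₂ ℕ.+ t ℕ.* (a ℕ.* a) ℕ.+ a ℕ.* a)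
      ...     | yes _   = ≤-refl
      ...     | no ¬low = ≤-reflexive (trans
        (cong₂ (λ u v → level Q (β (suc x)) (o (suc t) u v) (ζ (suc t) u))
               (line-step p₁ t a) (line-step p₂ t (a ℕ.* a)))
        (trans (level-here (suc t) (β≤Q (suc x))) (cong +_ (unmarked t≡τ refl refl refl))))
        where
        t≡τ : t ≡ τ x
        t≡τ with ℕ.m≤n⇒m<n∨m≡n t≤τ
        ... | inj₁ t<τ = contradiction (t<τ , line-step p₁ t a , line-step p₂ t (a ℕ.* a)) ¬low
        ... | inj₂ eq  = eq

      gadget-backward : ∀ t x z₁ z₂ b → b ℕ.< K →
        gadgetExcess t x z₁ z₂ ≤ gadgetExcess (suc t) x (z₁ ℕ.+ b) (z₂ ℕ.+ b ℕ.* b) + (L + L)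
      gadget-backward t x z₁ z₂ b b<K = begin
        gadgetExcess t x z₁ z₂
          ≤⟨ gadgetExcess≤level t x z₁ z₂ ⟩
        level Q h (o t z₁ z₂) (ζ t z₁)
          ≤⟨ level-backward Q h (o t z₁ z₂) (ζ t z₁) d ⟩
        level Q h (o t z₁ z₂ + d * d) (ζ t z₁ + d) + + w
          ≡⟨ cong (_+ + w) (level-step h t z₁ z₂ b) ⟨
        level Q h (o (suc t) (z₁ ℕ.+ b) (z₂ ℕ.+ b ℕ.* b)) (ζ (suc t) (z₁ ℕ.+ b)) + + w
          ≤⟨ +-monoˡ-≤ (+ w) (level≤1+gadgetExcess (suc t) x (z₁ ℕ.+ b) (z₂ ℕ.+ b ℕ.* b)) ⟩
        (1ℤ + e) + + w
          ≡⟨ identity e (+ w) ⟩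
        e + + suc w
          ≤⟨ +-monoʳ-≤ e (+≤+ w<2Λ) ⟩
        e + (L + L) ∎
        where
        open ≤-Reasoning
        h : ℕ
        h = β (suc x)
        d e : ℤ
        d = + b - A
        e = gadgetExcess (suc t) x (z₁ ℕ.+ b) (z₂ ℕ.+ b ℕ.* b)
        w : ℕ
        w = ∣ d ∣ ℕ.+ (∣ d ∣ ℕ.* ∣ d ∣ ℕ.+ ∣ d ∣ ℕ.* ∣ d ∣)
        identity : ∀ e w → (1ℤ + e) + w ≡ e + (1ℤ + w)
        identity = solve-∀
        d<K : ∣ d ∣ ℕ.< K
        d<K = ℕ.≤-<-trans (subst (λ i → ∣ i ∣ ℕ.≤ b ℕ.⊔ a) (sym (m-n≡m⊖n b a)) (∣m⊝n∣≤m⊔n b a))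
                          (ℕ.⊔-lub b<K a<K)
        d² : ∣ d ∣ ℕ.* ∣ d ∣ ℕ.≤ K ℕ.* K
        d² = ℕ.*-mono-≤ (ℕ.<⇒≤ d<K) (ℕ.<⇒≤ d<K)
        arrange : ∀ k e → k ℕ.+ (e ℕ.+ e) ≡ e ℕ.+ (e ℕ.+ k)
        arrange = ℕ-solve-∀
        w<2Λ : suc w ℕ.≤ Λ ℕ.+ Λ
        w<2Λ = ℕ.≤-trans (ℕ.+-mono-≤ d<K (ℕ.+-mono-≤ d² d²))
          (ℕ.≤-trans (ℕ.≤-reflexive (arrange K (K ℕ.* K)))
            (ℕ.+-mono-≤ (ℕ.m≤m+n (K ℕ.* K) K) ℕ.≤-refl))

      -- `base` rises by 1 along the step, which uses up `Λ` exactly. Forwards the excess must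
      -- therefore not increase; backwards there is room for twice `Λ`.
      inner-close : ∀ t x y z₁ z₂ b → b ℕ.< K →
        (Marked t x y z₁ z₂ → b ≡ a → β (suc x) ≡ β x) →
        Close L (potential t x y z₁ z₂) (potential (suc t) x y (z₁ ℕ.+ b) (z₂ ℕ.+ b ℕ.* b))
      inner-close t x y z₁ z₂ b b<K unmarked with onLine? x y
      ... | no  _ =
        ≤-reflexive (identity L (+ x * (+ ℓ + + suc (κ γ)) + (+ 2 * S * G) * (+ y - (+ y₀ + G * + x))) (+ t)) ,
        ≤-by {x = 0ℤ} {y = L + L} (+≤+ z≤n)
          (identity′ L (+ x * (+ ℓ + + suc (κ γ)) + (+ 2 * S * G) * (+ y - (+ y₀ + G * + x))) (+ t))
        where
        identity : ∀ l r t → l * (r + (1ℤ + t)) + 0ℤ ≡ (l * (r + t) + 0ℤ) + l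
        identity = solve-∀
        identity′ : ∀ l r t → ((l * (r + (1ℤ + t)) + 0ℤ) + l) - (l * (r + t) + 0ℤ) ≡ (l + l) - 0ℤ
        identity′ = solve-∀
      ... | yes y≡ =
        ≤-by (gadget-forward t x z₁ z₂ b λ t≡τ z₁≡ z₂≡ → unmarked (t≡τ , y≡ , z₁≡ , z₂≡))
          (identity L r (+ t) (gadgetExcess t x z₁ z₂) e′) ,
        ≤-by (gadget-backward t x z₁ z₂ b b<K) (identity′ L r (+ t) (gadgetExcess t x z₁ z₂) e′)
        where
        r e′ : ℤ
        r = + x * (+ ℓ + + suc (κ γ)) + (+ 2 * S * G) * (+ y - (+ y₀ + G * + x))
        e′ = gadgetExcess (suc t) x (z₁ ℕ.+ b) (z₂ ℕ.+ b ℕ.* b)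
        identity : ∀ l r t e e′ → ((l * (r + t) + e) + l) - (l * (r + (1ℤ + t)) + e′) ≡ e - e′
        identity = solve-∀
        identity′ : ∀ l r t e e′ →
          ((l * (r + (1ℤ + t)) + e′) + l) - (l * (r + t) + e) ≡ (e′ + (l + l)) - e
        identity′ = solve-∀

      -- Separation in the second coordinate is paired with equal first coordinates, because then
      -- the correction by 2aζ vanishes and `o` is just the difference of the second coordinates.
      Compatible : ℕ → ℕ → ℕ → ℕ → Set
      Compatible γ′ a′ p₁′ p₂′ = γ′ ≡ γ → a′ ≡ a ×
        ((p₁′ ≡ p₁ × p₂′ ≡ p₂) ⊎ Q ℕ.≤ ∣ + p₁′ - + p₁ ∣ ⊎ (p₁′ ≡ p₁ × Q ℕ.≤ ∣ + p₂′ - + p₂ ∣))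

      separated⇒far : ∀ p₁′ p₂′ →
        Q ℕ.≤ ∣ + p₁′ - + p₁ ∣ ⊎ (p₁′ ≡ p₁ × Q ℕ.≤ ∣ + p₂′ - + p₂ ∣) →
        Far Q ((+ p₂′ - + p₂) - + 2 * A * (+ p₁′ - + p₁)) (+ p₁′ - + p₁)
      separated⇒far p₁′ p₂′ (inj₁ Q≤)          = inj₂ Q≤
      separated⇒far p₁′ p₂′ (inj₂ (refl , Q≤)) =
        inj₁ (subst (λ i → Q ℕ.≤ ∣ i ∣) (identity (+ p₂′ - + p₂) (+ p₁) A) Q≤)
        where
        identity : ∀ q p a → q ≡ q - + 2 * a * (p - p)
        identity = solve-∀

      -- g² - (g - γ)² is linear in g, so the linear function `base` follows the tangent to the link
      -- length at `γ`. The subtracted square is what a wrong slope loses.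
      base-link : ∀ x y g →
        base 0 (suc x) (y ℕ.+ g) ≡ base ℓ x y + (+ suc (κ g) - S * ((+ g - G) * (+ g - G)))
      base-link x y g = trans
        (cong (λ k → + suc x * (+ ℓ + k) + (+ 2 * S * G) * ((+ y + + g) - (+ y₀ + G * + suc x)) + 0ℤ)
              (+κ≡ γ))
        (trans (identity (+ x) (+ y) (+ y₀) (+ g) G S (+ M) (+ ℓ))
          (cong₂ (λ k k′ → (+ x * (+ ℓ + k) + (+ 2 * S * G) * (+ y - (+ y₀ + G * + x)) + + ℓ)
                    + (k′ - S * ((+ g - G) * (+ g - G)))) (sym (+κ≡ γ)) (sym (+κ≡ g))))
        where
        identity : ∀ x y y₀ g G S M ℓ →
          (1ℤ + x) * (ℓ + (1ℤ + (S * (M * M + 1ℤ) + S * (G * G))))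
            + (+ 2 * S * G) * ((y + g) - (y₀ + G * (1ℤ + x))) + 0ℤ ≡
          (x * (ℓ + (1ℤ + (S * (M * M + 1ℤ) + S * (G * G)))) + (+ 2 * S * G) * (y - (y₀ + G * x)) + ℓ)
            + ((1ℤ + (S * (M * M + 1ℤ) + S * (g * g))) - S * ((g - G) * (g - G)))
        identity = solve-∀

      onLine-next : ∀ {x y} → OnLine x y → OnLine (suc x) (y ℕ.+ γ)
      onLine-next {x} refl = trans (ℕ.+-assoc y₀ _ γ)
        (cong (y₀ ℕ.+_) (trans (ℕ.+-comm (γ ℕ.* x) γ) (sym (ℕ.*-suc γ x))))

      onLine-prev : ∀ {x y} → OnLine (suc x) (y ℕ.+ γ) → OnLine x y
      onLine-prev {x} {y} eq = ℕ.+-cancelʳ-≡ γ y (y₀ ℕ.+ γ ℕ.* x) (trans eq (sym (onLine-next refl)))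

      -- Crossing a gadget in direction `a` changes neither `ζ` nor `o`, so both ends deviate
      -- equally. For a link of the line itself both values are `β (suc x)`; for another link
      -- between gadgets of the line the deviation is far and `β` drops out.
      excess-link : ∀ x y p₁′ p₂′ → Compatible γ a p₁′ p₂′ →
        excess 0 (suc x) (y ℕ.+ γ) p₁′ p₂′ ≡
        excess ℓ x y (p₁′ ℕ.+ ℓ ℕ.* a) (p₂′ ℕ.+ ℓ ℕ.* (a ℕ.* a))
      excess-link x y p₁′ p₂′ compat with onLine? x y | onLine? (suc x) (y ℕ.+ γ)
      ... | yes l | no ¬l = contradiction (onLine-next l) ¬l
      ... | no ¬l | yes l = contradiction (onLine-prev l) ¬l
      ... | no _  | no _  = refl
      ... | yes _ | yes _ with proj₂ (compat refl)
      ...   | inj₁ (refl , refl) = trans (gadgetExcess-in (suc x)) (sym (gadgetExcess-out x))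
      ...   | inj₂ separated = trans (gadgetExcess-far 0 (suc x) p₁′ p₂′ (subst₂ (Far Q) (sym o₀) (sym ζ₀) far))
        (trans (cong₂ (level Q 0) (trans o₀ (sym oℓ)) (trans ζ₀ (sym ζℓ)))
          (sym (gadgetExcess-far ℓ x _ _ (subst₂ (Far Q) (sym oℓ) (sym ζℓ) far))))
        where
        δ₁ δ : ℤ
        δ₁ = + p₁′ - + p₁
        δ = (+ p₂′ - + p₂) - + 2 * A * δ₁
        ζℓ : ζ ℓ (p₁′ ℕ.+ ℓ ℕ.* a) ≡ δ₁
        ζℓ = ζ-line ℓ p₁′
        oℓ : o ℓ (p₁′ ℕ.+ ℓ ℕ.* a) (p₂′ ℕ.+ ℓ ℕ.* (a ℕ.* a)) ≡ δ
        oℓ = o-line ℓ p₁′ p₂′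
        ζ₀ : ζ 0 p₁′ ≡ δ₁
        ζ₀ = trans (cong (ζ 0) (sym (ℕ.+-identityʳ p₁′))) (ζ-line 0 p₁′)
        o₀ : o 0 p₁′ p₂′ ≡ δ
        o₀ = trans (cong₂ (o 0) (sym (ℕ.+-identityʳ p₁′)) (sym (ℕ.+-identityʳ p₂′))) (o-line 0 p₁′ p₂′)
        far : Far Q δ δ₁
        far = separated⇒far p₁′ p₂′ separated

      link-close-same : ∀ {r r′ e e′ k} g → r′ ≡ r + (k - S * ((g - g) * (g - g))) → e′ ≡ e → 0ℤ ≤ L * k →
        Close (L * k) (L * r + e) (L * r′ + e′)
      link-close-same {r} {e = e} {k = k} g refl refl 0≤Lk =
        ≤-reflexive (identity L r k g S e) , ≤-by (+-mono-≤ 0≤Lk 0≤Lk) (identity′ L r k g S e)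
        where
        identity : ∀ l r k g s e → l * (r + (k - s * ((g - g) * (g - g)))) + e ≡ (l * r + e) + l * k
        identity = solve-∀
        identity′ : ∀ l r k g s e →
          ((l * (r + (k - s * ((g - g) * (g - g)))) + e) + l * k) - (l * r + e) ≡ (l * k + l * k) - 0ℤ
        identity′ = solve-∀

      -- A wrong slope loses at least Λs = `Q`, enough for any change of an excess between 0 and
      -- `Q`. Backwards the length of the link has to make up for s·d², as the last premise ensures.
      link-close-other : ∀ {r r′ e e′ k} d → r′ ≡ r + (k - S * (d * d)) →
        0ℤ ≤ e → e ≤ + Q → 0ℤ ≤ e′ → e′ ≤ + Q → 1ℤ ≤ d * d → S * (d * d) + S ≤ k + k →
        Close (L * k) (L * r + e) (L * r′ + e′)
      link-close-other {r} {e = e} {e′} {k} d refl 0≤e e≤Q 0≤e′ e′≤Q 1≤d² bound =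
        ≤-by₃ (LS-mono 1≤d²) e′≤Q 0≤e (trans (identity L r k S d e e′)
          (cong (λ q → (L * S * (d * d) - L * S * 1ℤ) + (q - e′) + (e - 0ℤ)) (sym +Q≡))) ,
        ≤-by₃ (*-monoˡ-≤-nonNeg L bound) e≤Q 0≤e′ (trans (identity′ L r k S d e e′)
          (cong (λ q → (L * (k + k) - L * (S * (d * d) + S)) + (q - e) + (e′ - 0ℤ)) (sym +Q≡)))
        where
        LS-mono : ∀ {i j} → i ≤ j → L * S * i ≤ L * S * j
        LS-mono i≤j = subst (λ q → q * _ ≤ q * _) +Q≡ (*-monoˡ-≤-nonNeg (+ Q) i≤j)
        identity : ∀ l r k s d e e′ →
          ((l * r + e) + l * k) - (l * (r + (k - s * (d * d))) + e′) ≡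
          (l * s * (d * d) - l * s * 1ℤ) + (l * s - e′) + (e - 0ℤ)
        identity = solve-∀
        identity′ : ∀ l r k s d e e′ →
          ((l * (r + (k - s * (d * d))) + e′) + l * k) - (l * r + e) ≡
          (l * (k + k) - l * (s * (d * d) + s)) + (l * s - e) + (e′ - 0ℤ)
        identity′ = solve-∀

      -- The constant part s(M² + 1) of `κ` provides this, since slopes below `M` differ by at most
      -- `M`.
      κ-bound : ∀ g → g ℕ.< M → S * ((+ g - G) * (+ g - G)) + S ≤ + suc (κ g) + + suc (κ g)
      κ-bound g g<M = begin
        S * (D * D) + S
          ≡⟨ cong (λ i → S * i + S) (∣i∣²≡i*i D) ⟨
        S * + (∣ D ∣ ℕ.* ∣ D ∣) + S
          ≡⟨ cong (_+ S) (pos-* s (∣ D ∣ ℕ.* ∣ D ∣)) ⟨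
        + (s ℕ.* (∣ D ∣ ℕ.* ∣ D ∣) ℕ.+ s)
          ≤⟨ +≤+ bound ⟩
        + suc (κ g) + + suc (κ g) ∎
        where
        open ≤-Reasoning
        D : ℤ
        D = + g - G
        D≤M : ∣ D ∣ ℕ.≤ M
        D≤M = ℕ.≤-trans (subst (λ i → ∣ i ∣ ℕ.≤ g ℕ.⊔ γ) (sym (m-n≡m⊖n g γ)) (∣m⊝n∣≤m⊔n g γ))
                        (ℕ.⊔-lub (ℕ.<⇒≤ g<M) (ℕ.<⇒≤ γ<M))
        arrange : ∀ s m → s ℕ.* m ℕ.+ s ≡ s ℕ.* (m ℕ.+ 1)
        arrange = ℕ-solve-∀
        bound : s ℕ.* (∣ D ∣ ℕ.* ∣ D ∣) ℕ.+ s ℕ.≤ suc (κ g) ℕ.+ suc (κ g)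
        bound = ℕ.≤-trans (ℕ.+-monoˡ-≤ s (ℕ.*-monoʳ-≤ s (ℕ.*-mono-≤ D≤M D≤M)))
          (ℕ.≤-trans (ℕ.≤-reflexive (arrange s (M ℕ.* M)))
            (ℕ.≤-trans (ℕ.m≤m+n (s ℕ.* (M ℕ.* M ℕ.+ 1)) (s ℕ.* (g ℕ.* g)))
              (ℕ.≤-trans (ℕ.n≤1+n (κ g)) (ℕ.m≤m+n (suc (κ g)) (suc (κ g))))))

      link-close : ∀ x y γ′ a′ p₁′ p₂′ → γ′ ℕ.< M → Compatible γ′ a′ p₁′ p₂′ →
        Close (L * + suc (κ γ′))
          (potential ℓ x y (p₁′ ℕ.+ ℓ ℕ.* a′) (p₂′ ℕ.+ ℓ ℕ.* (a′ ℕ.* a′)))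
          (potential 0 (suc x) (y ℕ.+ γ′) p₁′ p₂′)
      link-close x y γ′ a′ p₁′ p₂′ γ′<M compat with γ′ ℕ.≟ γ
      ... | yes refl with refl ← proj₁ (compat refl) =
        link-close-same G (base-link x y γ) (excess-link x y p₁′ p₂′ compat)
          (subst (0ℤ ≤_) (pos-* Λ (suc (κ γ))) (+≤+ z≤n))
      ... | no γ′≢γ = link-close-other (+ γ′ - G) (base-link x y γ′)
        (0≤excess ℓ x y _ _) (excess≤Q ℓ x y _ _) (0≤excess 0 (suc x) (y ℕ.+ γ′) _ _)
        (excess≤Q 0 (suc x) (y ℕ.+ γ′) _ _)
        (1≤i*i (+ γ′ - G) λ D≡0 → γ′≢γ (+-injective (i-j≡0⇒i≡j (+ γ′) G D≡0)))
        (κ-bound γ′ γ′<M)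

-- The graph of gadgets and links.

module Construction where
  open import Defs
  open import Data.Fin as Fin using (Fin; toℕ; combine; remQuot; fromℕ<)
  import Data.Fin.Properties as Fin
  open import Data.Integer as ℤ using (ℤ)
  import Data.Integer.Properties as ℤ
  import Data.Integer.Tactic.RingSolver as ℤ
  open import Data.List using (List; length; filter; map; downFrom; allFin; cartesianProduct)
  open import Data.List.Membership.Propositional using (_∈_; find; lose)
  open import Data.List.Membership.Propositional.Properties
    using (∈-allFin; ∈-cartesianProduct⁺; ∈-cartesianProduct⁻; ∈-filter⁺; ∈-filter⁻; ∈-downFrom⁻)
  open import Data.List.Properties using (length-map; length-downFrom; length-tabulate)
  open import Data.List.Relation.Unary.Any using (any?)
  open import Data.List.Relation.Unary.Unique.Propositional using (Unique)
  open import Data.List.Relation.Unary.Unique.Propositional.Properties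
    using (allFin⁺; cartesianProduct⁺; downFrom⁺; filter⁺; map⁺)
  open import Data.Nat
  open import Data.Nat.DivMod using (_mod_; m<n⇒m%n≡m; m%n<n)
  open import Data.Nat.Properties
  open import Data.Product using (∃; _×_; _,_; proj₁; proj₂)
  open import Data.Product.Function.NonDependent.Propositional using (_×-↔_)
  open import Data.Sum using (_⊎_; inj₁; inj₂; swap)
  open import Data.Sum.Properties using (inj₁-injective)
  open import Data.Sum.Function.Propositional using (_⊎-↔_)
  open import Function using (_∘_; _↔_; Inverse)
  open import Function.Properties.Inverse using (↔-refl; ↔-trans)
  open import Relation.Binary.PropositionalEquality
  open import Relation.Nullary using (Dec; yes; no; ¬_; contradiction; ¬?)
  open import Relation.Nullary.Decidable using (_×-dec_; _⊎-dec_; decidable-stable)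
  open import Relation.Nullary.Construct.Add.Supremum using ([_])
  open Graphs
  open Potential

  toℕ-mod : ∀ {m n} .{{_ : NonZero n}} → m < n → toℕ (m mod n) ≡ m
  toℕ-mod {m} {n} m<n = trans (Fin.toℕ-fromℕ< (m%n<n m n)) (m<n⇒m%n≡m m<n)

  mod-unique : ∀ {m n} .{{_ : NonZero n}} (i : Fin n) → toℕ i ≡ m → i ≡ m mod n
  mod-unique i refl = Fin.toℕ-injective (sym (toℕ-mod (Fin.toℕ<n i)))

  module Gadgets (K R g ℓ s X′ Y Y₂ Z : ℕ) .{{_ : NonZero Y₂}} .{{_ : NonZero Z}} where

    X M : ℕ
    X = suc X′
    M = K * (R * R)

    open Parameters K M ℓ s public

    -- All links get equally many slots, so that the link vertices form a product. The slots from
    -- `κ` on are a pendant path behind the last interior vertex.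
    κ-max : ℕ
    κ-max = s * (M * M + 1) + s * (M * M)

    -- One number serves as the slope of a link and, in mixed radix, as a direction with two
    -- residues modulo `R`. Equal slopes thus force equal directions and starting positions that
    -- differ by multiples of `R`.
    Colour : Set
    Colour = Fin M

    direction : Colour → ℕ
    direction c = toℕ (proj₁ (remQuot {K} (R * R) c))

    residue₁ residue₂ : Colour → Fin R
    residue₁ c = proj₁ (remQuot {R} R (proj₂ (remQuot {K} (R * R) c)))
    residue₂ c = proj₂ (remQuot {R} R (proj₂ (remQuot {K} (R * R) c)))

    start₁ start₂ : Colour → Fin g → ℕ
    start₁ c q = toℕ (combine q (residue₁ c))
    start₂ c q = toℕ (combine q (residue₂ c))

    Inner Link Vertex : Set
    Inner = Fin (suc ℓ) × Fin X × Fin Y₂ × Fin Z × Fin Z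
    Link = Fin X × Fin Y₂ × Colour × Fin g × Fin g × Fin κ-max
    Vertex = Inner ⊎ Link

    -- Inside a gadget the steps (b, b²) are in strictly convex position; links
    -- of colour c lead from the gadget at (x, y) to the one at (x + 1, y + c).
    Step : Vertex → Vertex → Set
    Step (inj₁ (t , x , y , z₁ , z₂)) (inj₁ (t′ , x′ , y′ , z₁′ , z₂′)) =
      toℕ t′ ≡ suc (toℕ t) × x′ ≡ x × y′ ≡ y ×
      ∃ λ (b : Fin K) → toℕ z₁′ ≡ toℕ z₁ + toℕ b × toℕ z₂′ ≡ toℕ z₂ + toℕ b * toℕ b
    Step (inj₁ (t , x , y , z₁ , z₂)) (inj₂ (x′ , y′ , c , q₁ , q₂ , j)) =
      toℕ t ≡ ℓ × x′ ≡ x × y′ ≡ y ×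
      toℕ z₁ ≡ start₁ c q₁ + ℓ * direction c ×
      toℕ z₂ ≡ start₂ c q₂ + ℓ * (direction c * direction c) ×
      toℕ j ≡ 0
    Step (inj₂ (x , y , c , q₁ , q₂ , j)) (inj₂ (x′ , y′ , c′ , q₁′ , q₂′ , j′)) =
      x′ ≡ x × y′ ≡ y × c′ ≡ c × q₁′ ≡ q₁ × q₂′ ≡ q₂ × toℕ j′ ≡ suc (toℕ j)
    Step (inj₂ (x , y , c , q₁ , q₂ , j)) (inj₁ (t , x′ , y′ , z₁ , z₂)) =
      suc (toℕ j) ≡ κ (toℕ c) × toℕ t ≡ 0 × toℕ x′ ≡ suc (toℕ x) × toℕ y′ ≡ toℕ y + toℕ c ×
      toℕ z₁ ≡ start₁ c q₁ × toℕ z₂ ≡ start₂ c q₂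

    step? : ∀ v w → Dec (Step v w)
    step? (inj₁ (t , x , y , z₁ , z₂)) (inj₁ (t′ , x′ , y′ , z₁′ , z₂′)) =
      (toℕ t′ ≟ suc (toℕ t)) ×-dec (x′ Fin.≟ x) ×-dec (y′ Fin.≟ y) ×-dec
      Fin.any? λ b → (toℕ z₁′ ≟ toℕ z₁ + toℕ b) ×-dec (toℕ z₂′ ≟ toℕ z₂ + toℕ b * toℕ b)
    step? (inj₁ (t , x , y , z₁ , z₂)) (inj₂ (x′ , y′ , c , q₁ , q₂ , j)) =
      (toℕ t ≟ ℓ) ×-dec (x′ Fin.≟ x) ×-dec (y′ Fin.≟ y) ×-dec
      (toℕ z₁ ≟ start₁ c q₁ + ℓ * direction c) ×-dec
      (toℕ z₂ ≟ start₂ c q₂ + ℓ * (direction c * direction c)) ×-dec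
      (toℕ j ≟ 0)
    step? (inj₂ (x , y , c , q₁ , q₂ , j)) (inj₂ (x′ , y′ , c′ , q₁′ , q₂′ , j′)) =
      (x′ Fin.≟ x) ×-dec (y′ Fin.≟ y) ×-dec (c′ Fin.≟ c) ×-dec (q₁′ Fin.≟ q₁) ×-dec
      (q₂′ Fin.≟ q₂) ×-dec (toℕ j′ ≟ suc (toℕ j))
    step? (inj₂ (x , y , c , q₁ , q₂ , j)) (inj₁ (t , x′ , y′ , z₁ , z₂)) =
      (suc (toℕ j) ≟ κ (toℕ c)) ×-dec (toℕ t ≟ 0) ×-dec (toℕ x′ ≟ suc (toℕ x)) ×-dec
      (toℕ y′ ≟ toℕ y + toℕ c) ×-dec (toℕ z₁ ≟ start₁ c q₁) ×-dec (toℕ z₂ ≟ start₂ c q₂)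

    step-irreflexive : ∀ v → ¬ Step v v
    step-irreflexive (inj₁ _) (t≡1+t , _)             = 1+n≢n (sym t≡1+t)
    step-irreflexive (inj₂ _) (_ , _ , _ , _ , _ , j≡1+j) = 1+n≢n (sym j≡1+j)

    order : ℕ
    order = suc ℓ * (X * (Y₂ * (Z * Z))) + X * (Y₂ * (M * (g * (g * κ-max))))

    code : Fin order ↔ Vertex
    code = ↔-trans Fin.+↔⊎
      (↔-trans Fin.*↔× (↔-refl ×-↔ ↔-trans Fin.*↔× (↔-refl ×-↔ ↔-trans Fin.*↔×
        (↔-refl ×-↔ Fin.*↔×)))
      ⊎-↔
      ↔-trans Fin.*↔× (↔-refl ×-↔ ↔-trans Fin.*↔× (↔-refl ×-↔ ↔-trans Fin.*↔×
        (↔-refl ×-↔ ↔-trans Fin.*↔× (↔-refl ×-↔ Fin.*↔×)))))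

    abstract
      decode : Fin order → Vertex
      decode = Inverse.to code

      encode : Vertex → Fin order
      encode = Inverse.from code

      decode-encode : ∀ v → decode (encode v) ≡ v
      decode-encode = Inverse.strictlyInverseˡ code

      encode-decode : ∀ u → encode (decode u) ≡ u
      encode-decode = Inverse.strictlyInverseʳ code

      -- `edgeCount` sees an edge from its smaller end only. The layer is the leading digit of the
      -- code, so gadget edges point upwards.
      encode-< : ∀ {t t′ : Fin (suc ℓ)} r r′ → t Fin.< t′ →
                 encode (inj₁ (t , r)) Fin.< encode (inj₁ (t′ , r′))
      encode-< {t} {t′} r r′ t<t′ = subst₂ _<_
        (sym (Fin.toℕ-↑ˡ (combine t _) (X * (Y₂ * (M * (g * (g * κ-max)))))))
        (sym (Fin.toℕ-↑ˡ (combine t′ _) (X * (Y₂ * (M * (g * (g * κ-max)))))))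
        (Fin.combine-monoˡ-< {i = t} {t′} _ _ t<t′)

    encode-injective : ∀ {v w} → encode v ≡ encode w → v ≡ w
    encode-injective {v} {w} eq =
      trans (sym (decode-encode v)) (trans (cong decode eq) (decode-encode w))

    encoded : ∀ {u w} → decode u ≡ w → u ≡ encode w
    encoded {u} eq = trans (sym (encode-decode u)) (cong encode eq)

    graph : Graph order
    graph = record
      { Adj         = λ u v → Step (decode u) (decode v) ⊎ Step (decode v) (decode u)
      ; adj?        = λ u v → step? (decode u) (decode v) ⊎-dec step? (decode v) (decode u)
      ; symmetric   = swap
      ; irreflexive = λ { {u} refl (inj₁ st) → step-irreflexive (decode u) st
                        ; {u} refl (inj₂ st) → step-irreflexive (decode u) st }
      }

    adjacent : ∀ {v w} → Step v w → Graph.Adj graph (encode v) (encode w)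
    adjacent {v} {w} st = inj₁ (subst₂ Step (sym (decode-encode v)) (sym (decode-encode w)) st)

    Line : Set
    Line = Fin Y × Colour × Fin g × Fin g

    module _ (i : Line) where
      private
        y₀ = proj₁ i
        c  = proj₁ (proj₂ i)
        q₁ = proj₁ (proj₂ (proj₂ i))
        q₂ = proj₂ (proj₂ (proj₂ i))

      row position₁ position₂ : ℕ → ℕ
      row x       = toℕ y₀ + toℕ c * x
      position₁ t = start₁ c q₁ + t * direction c
      position₂ t = start₂ c q₂ + t * (direction c * direction c)

      -- Reduction modulo the ranges gives a vertex for all arguments. For actual layers and columns
      -- nothing wraps round, by `row<Y₂`, `position₁<Z` and `position₂<Z`.
      node : ℕ → ℕ → Vertex
      node t x = inj₁ (t mod suc ℓ , x mod X , row x mod Y₂ , position₁ t mod Z , position₂ t mod Z)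

      vertex : ℕ → ℕ → Fin order
      vertex t x = encode (node t x)

      source target : Fin order
      source = vertex 0 0
      target = vertex ℓ X′

      lineLength : ℕ
      lineLength = X′ * period (toℕ c) + ℓ

    -- Walks along the lines.

    module Bounds (Y₂-large : Y + M * X ≤ Y₂) (Z-large : g * R + ℓ * (K * K) ≤ Z) where

      direction<K : ∀ c → direction c < K
      direction<K c = Fin.toℕ<n (proj₁ (remQuot {K} (R * R) c))

      module _ (i : Line) where
        private
          y₀ = proj₁ i
          c  = proj₁ (proj₂ i)
          q₁ = proj₁ (proj₂ (proj₂ i))
          q₂ = proj₂ (proj₂ (proj₂ i))

        row<Y₂ : ∀ {x} → x < X → row i x < Y₂
        row<Y₂ x<X = <-≤-trans (+-mono-<-≤ (Fin.toℕ<n y₀)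
          (*-mono-≤ (<⇒≤ (Fin.toℕ<n c)) (<⇒≤ x<X))) Y₂-large

        private
          d≤K² : direction c ≤ K * K
          d≤K² = ≤-trans (<⇒≤ (direction<K c)) (m≤m*n K K {{>-nonZero (≤-<-trans z≤n (direction<K c))}})

        position₁<Z : ∀ {t} → t ≤ ℓ → position₁ i t < Z
        position₁<Z t≤ℓ = <-≤-trans (+-mono-<-≤ (Fin.toℕ<n (combine q₁ (residue₁ c)))
          (*-mono-≤ t≤ℓ d≤K²)) Z-large

        position₂<Z : ∀ {t} → t ≤ ℓ → position₂ i t < Z
        position₂<Z t≤ℓ = <-≤-trans (+-mono-<-≤ (Fin.toℕ<n (combine q₂ (residue₂ c)))
          (*-mono-≤ t≤ℓ (*-mono-≤ (<⇒≤ (direction<K c)) (<⇒≤ (direction<K c))))) Z-large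

        step-inner : ∀ {t x} → t < ℓ → Step (node i t x) (node i (suc t) x)
        step-inner {t} {x} t<ℓ =
          trans (toℕ-mod (s≤s t<ℓ)) (cong suc (sym (toℕ-mod (m<n⇒m<1+n t<ℓ)))) , refl , refl ,
          proj₁ (remQuot {K} (R * R) c) ,
          trans (toℕ-mod (position₁<Z t<ℓ)) (trans (sym (line-step (start₁ c q₁) t (direction c)))
            (cong (_+ direction c) (sym (toℕ-mod (position₁<Z (<⇒≤ t<ℓ)))))) ,
          trans (toℕ-mod (position₂<Z t<ℓ)) (trans (sym (line-step (start₂ c q₂) t (direction c * direction c)))
            (cong (_+ direction c * direction c) (sym (toℕ-mod (position₂<Z (<⇒≤ t<ℓ))))))

        walk-inner : ∀ {x} t → t ≤ ℓ → Walk graph (vertex i 0 x) (vertex i t x) t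
        walk-inner zero    _   = nil
        walk-inner (suc t) t<ℓ = snoc (walk-inner t (<⇒≤ t<ℓ)) (adjacent (step-inner t<ℓ))

        linkNode : ∀ x j → j < κ-max → Vertex
        linkNode x j j<κ = inj₂ (x mod X , row i x mod Y₂ , c , q₁ , q₂ , fromℕ< j<κ)

        walk-link : ∀ x j (j<κ : j < κ-max) →
                    Walk graph (vertex i ℓ x) (encode (linkNode x j j<κ)) (suc j)
        walk-link x zero j<κ = cons (adjacent {node i ℓ x} {linkNode x 0 j<κ}
          ( toℕ-mod (n<1+n ℓ) , refl , refl , toℕ-mod (position₁<Z ≤-refl)
          , toℕ-mod (position₂<Z ≤-refl) , Fin.toℕ-fromℕ< j<κ)) nil
        walk-link x (suc j) j<κ = snoc (walk-link x j (<⇒≤ j<κ))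
          (adjacent {linkNode x j (<⇒≤ j<κ)} {linkNode x (suc j) j<κ}
            ( refl , refl , refl , refl , refl
            , trans (Fin.toℕ-fromℕ< j<κ) (cong suc (sym (Fin.toℕ-fromℕ< (<⇒≤ j<κ))))))

        κ≤κ-max : κ (toℕ c) ≤ κ-max
        κ≤κ-max = +-monoʳ-≤ (s * (M * M + 1)) (*-monoʳ-≤ s (*-mono-≤ c≤M c≤M))
          where
          c≤M : toℕ c ≤ M
          c≤M = <⇒≤ (Fin.toℕ<n c)

        walk-between : 1 ≤ s → ∀ {x} → suc x < X →
          Walk graph (vertex i ℓ x) (vertex i 0 (suc x)) (suc (κ (toℕ c)))
        walk-between 1≤s {x} 1+x<X with κ (toℕ c) in eq
        -- `κ` is at least `s`, so every link has an interior vertex.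
        ... | zero  = contradiction eq
          (m<n⇒n≢0 (≤-trans (*-mono-≤ 1≤s (m≤n+m 1 (M * M))) (m≤m+n (s * (M * M + 1)) (s * (toℕ c * toℕ c)))))
        ... | suc j = snoc (walk-link x j j<κ) (adjacent {linkNode x j j<κ} {node i 0 (suc x)}
          ( trans (cong suc (Fin.toℕ-fromℕ< j<κ)) (sym eq) , toℕ-mod {0} {suc ℓ} (s≤s z≤n)
          , trans (toℕ-mod 1+x<X) (cong suc (sym (toℕ-mod (<⇒≤ 1+x<X))))
          , trans (toℕ-mod (row<Y₂ 1+x<X))
              (trans (trans (cong (toℕ y₀ +_) (trans (*-suc (toℕ c) x) (+-comm (toℕ c) _)))
                (sym (+-assoc (toℕ y₀) (toℕ c * x) (toℕ c))))
                (cong (_+ toℕ c) (sym (toℕ-mod (row<Y₂ (<⇒≤ 1+x<X))))))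
          , trans (toℕ-mod (position₁<Z z≤n)) (+-identityʳ _)
          , trans (toℕ-mod (position₂<Z z≤n)) (+-identityʳ _)))
          where
          j<κ : j < κ-max
          j<κ = ≤-trans (≤-reflexive (sym eq)) κ≤κ-max

        walk-line : 1 ≤ s → ∀ x → x < X →
                    Walk graph (source i) (vertex i ℓ x) (x * period (toℕ c) + ℓ)
        walk-line 1≤s zero    _     = walk-inner ℓ ≤-refl
        walk-line 1≤s (suc x) 1+x<X = subst (Walk graph (source i) (vertex i ℓ (suc x)))
          (arrange (x * period (toℕ c)) ℓ (suc (κ (toℕ c))))
          ((walk-line 1≤s x (<⇒≤ 1+x<X) ++ʷ walk-between 1≤s 1+x<X) ++ʷ walk-inner ℓ ≤-refl)
          where
          arrange : ∀ m l k → m + l + k + l ≡ l + k + m + l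
          arrange m l k = cong (_+ l) (trans (+-assoc m l k) (+-comm m (l + k)))

      separated : ∀ (ρ : Fin R) {q q′ : Fin g} → q′ ≢ q →
                  R ≤ ℤ.∣ ℤ.+ toℕ (combine q′ ρ) ℤ.- ℤ.+ toℕ (combine q ρ) ∣
      separated ρ {q} {q′} q′≢q = subst (R ≤_) (sym (trans (cong ℤ.∣_∣ (trans
          (cong₂ (λ m n → m ℤ.- n) (split q′) (split q))
          (identity (ℤ.+ R) (ℤ.+ toℕ q′) (ℤ.+ toℕ q) (ℤ.+ toℕ ρ))))
          (ℤ.∣i*j∣≡∣i∣*∣j∣ (ℤ.+ R) (ℤ.+ toℕ q′ ℤ.- ℤ.+ toℕ q))))
        (m≤m*n R ℤ.∣ ℤ.+ toℕ q′ ℤ.- ℤ.+ toℕ q ∣ {{≢-nonZero λ eq → q′≢q (Fin.toℕ-injective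
          (ℤ.+-injective (ℤ.i-j≡0⇒i≡j (ℤ.+ toℕ q′) (ℤ.+ toℕ q) (ℤ.∣i∣≡0⇒i≡0 eq))))}})
        where
        split : ∀ q → ℤ.+ toℕ (combine q ρ) ≡ ℤ.+ R ℤ.* ℤ.+ toℕ q ℤ.+ ℤ.+ toℕ ρ
        split q = trans (cong ℤ.+_ (Fin.toℕ-combine q ρ))
                        (cong (λ m → m ℤ.+ ℤ.+ toℕ ρ) (ℤ.pos-* R (toℕ q)))
        identity : ∀ r m n k → (r ℤ.* m ℤ.+ k) ℤ.- (r ℤ.* n ℤ.+ k) ≡ r ℤ.* (m ℤ.- n)
        identity = ℤ.solve-∀

      -- Lower bound for walks between the ends of a line.

      module LowerBound (1≤s : 1 ≤ s) (Q≤R : Q ≤ R) (i : Line)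
        (τ β : ℕ → ℕ) (τ<ℓ : ∀ x → τ x < ℓ) (β≤Q : ∀ x → β x ≤ Q)
        (β-mono : ∀ x → β x ≤ β (suc x)) (β-step : ∀ x → β (suc x) ≤ suc (β x))
        (H : Graph order) (H⊆G : H ⊆ᴳ graph) where

        private
          y₀ = proj₁ i
          c  = proj₁ (proj₂ i)
          q₁ = proj₁ (proj₂ (proj₂ i))
          q₂ = proj₂ (proj₂ (proj₂ i))

        open Potential.Line K M ℓ s 1≤s (toℕ y₀) (toℕ c) (direction c) (start₁ c q₁) (start₂ c q₂)
          (Fin.toℕ<n c) (direction<K c) τ β τ<ℓ β≤Q β-mono β-step

        -- Equal slopes mean equal colours, hence equal directions and residues. Different starts
        -- are then at least `R`, hence at least `Q`, apart.
        compatible : ∀ c′ q₁′ q₂′ →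
          Compatible (toℕ c′) (direction c′) (start₁ c′ q₁′) (start₂ c′ q₂′)
        compatible c′ q₁′ q₂′ c′≡c with refl ← Fin.toℕ-injective c′≡c with q₁′ Fin.≟ q₁ | q₂′ Fin.≟ q₂
        ... | yes refl | yes refl = refl , inj₁ (refl , refl)
        ... | no q₁′≢q₁ | _       = refl , inj₂ (inj₁ (≤-trans Q≤R (separated (residue₁ c) q₁′≢q₁)))
        ... | yes refl | no q₂′≢q₂ =
          refl , inj₂ (inj₂ (refl , ≤-trans Q≤R (separated (residue₂ c) q₂′≢q₂)))

        -- These are formulas in the coordinates and not values at vertices, since a link near the
        -- border may have no gadget at its far end.
        exit enter : Fin X → Fin Y₂ → Colour → Fin g → Fin g → ℤ
        exit x y c′ q₁′ q₂′ = potential ℓ (toℕ x) (toℕ y)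
          (start₁ c′ q₁′ + ℓ * direction c′) (start₂ c′ q₂′ + ℓ * (direction c′ * direction c′))
        enter x y c′ q₁′ q₂′ =
          potential 0 (suc (toℕ x)) (toℕ y + toℕ c′) (start₁ c′ q₁′) (start₂ c′ q₂′)

        -- On a link the potential is the largest Λ-Lipschitz extension of its
        -- values at the two ends.
        Φ : Vertex → ℤ
        Φ (inj₁ (t , x , y , z₁ , z₂)) = potential (toℕ t) (toℕ x) (toℕ y) (toℕ z₁) (toℕ z₂)
        Φ (inj₂ (x , y , c′ , q₁′ , q₂′ , j)) =
          (exit x y c′ q₁′ q₂′ ℤ.+ L ℤ.* ℤ.+ suc (toℕ j)) ℤ.⊓
          (enter x y c′ q₁′ q₂′ ℤ.+ L ℤ.* ℤ.+ (κ (toℕ c′) ∸ toℕ j))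

        grow : ∀ k p → p ℤ.+ L ℤ.* ℤ.+ suc k ≡ (p ℤ.+ L ℤ.* ℤ.+ k) ℤ.+ L
        grow k p = identity p L (ℤ.+ k)
          where
          identity : ∀ p l k → p ℤ.+ l ℤ.* (ℤ.1ℤ ℤ.+ k) ≡ (p ℤ.+ l ℤ.* k) ℤ.+ l
          identity = ℤ.solve-∀

        +L-mono : ∀ {m n} p → m ≤ n → p ℤ.+ L ℤ.* ℤ.+ m ℤ.≤ p ℤ.+ L ℤ.* ℤ.+ n
        +L-mono p m≤n = ℤ.+-monoʳ-≤ p (ℤ.*-monoˡ-≤-nonNeg L (ℤ.+≤+ m≤n))

        +L-step : ∀ {m n} p → m ≤ suc n → p ℤ.+ L ℤ.* ℤ.+ m ℤ.≤ (p ℤ.+ L ℤ.* ℤ.+ n) ℤ.+ L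
        +L-step {m} {n} p m≤1+n = ℤ.≤-trans (+L-mono p m≤1+n) (ℤ.≤-reflexive (grow n p))

        ⊓-glb-+L : ∀ {p} q r → p ℤ.≤ q ℤ.+ L → p ℤ.≤ r ℤ.+ L → p ℤ.≤ (q ℤ.⊓ r) ℤ.+ L
        ⊓-glb-+L q r p≤q p≤r = ℤ.≤-trans (ℤ.⊓-glb p≤q p≤r)
          (ℤ.≤-reflexive (sym (ℤ.mono-≤-distrib-⊓ {f = ℤ._+ L} (ℤ.+-monoˡ-≤ L) q r)))

        p+L*1 : ∀ p → p ℤ.+ L ℤ.* ℤ.+ 1 ≡ p ℤ.+ L
        p+L*1 p = cong (λ m → p ℤ.+ m) (ℤ.*-identityʳ L)

        p+L*0 : ∀ p → p ℤ.+ L ℤ.* ℤ.+ 0 ≡ p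
        p+L*0 p = trans (cong (λ m → p ℤ.+ m) (ℤ.*-zeroʳ L)) (ℤ.+-identityʳ p)

        -- Gadget edges are `inner-close`. On a link the minimum of two functions of slope `Λ` is
        -- Lipschitz, and it fits the values at both ends because `link-close` bounds their
        -- difference. The premise concerns the one edge per column at which the excess may jump.
        Φ-close : ∀ v w → Step v w →
          (∀ x → v ≡ node i (τ x) x → w ≡ node i (suc (τ x)) x → β (suc x) ≡ β x) →
          Close L (Φ v) (Φ w)
        Φ-close (inj₁ (t , x , y , z₁ , z₂)) (inj₁ (t′ , x , y , z₁′ , z₂′))
          (t′≡ , refl , refl , b , z₁′≡ , z₂′≡) unmarked
          = subst (λ t′ → Close L _ (potential t′ (toℕ x) (toℕ y) (toℕ z₁′) (toℕ z₂′))) (sym t′≡)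
            (subst₂ (λ m n → Close L _ (potential (suc (toℕ t)) (toℕ x) (toℕ y) m n)) (sym z₁′≡) (sym z₂′≡)
              (inner-close (toℕ t) (toℕ x) (toℕ y) (toℕ z₁) (toℕ z₂) (toℕ b) (Fin.toℕ<n b) marked))
          where
          marked : Marked (toℕ t) (toℕ x) (toℕ y) (toℕ z₁) (toℕ z₂) → toℕ b ≡ direction c →
                   β (suc (toℕ x)) ≡ β (toℕ x)
          marked (t≡τ , y≡ , z₁≡ , z₂≡) b≡ = unmarked (toℕ x)
            (at (τ (toℕ x)) (mod-unique t t≡τ)
                (mod-unique z₁ (trans z₁≡ (cong (λ t → start₁ c q₁ + t * direction c) t≡τ)))
                (mod-unique z₂ (trans z₂≡ (cong (λ t → start₂ c q₂ + t * (direction c * direction c)) t≡τ))))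
            (at (suc (τ (toℕ x))) (mod-unique t′ (trans t′≡ (cong suc t≡τ)))
                (mod-unique z₁′ (trans z₁′≡ (trans (cong₂ _+_ z₁≡ b≡)
                  (trans (line-step (start₁ c q₁) (toℕ t) (direction c))
                    (cong (λ t → start₁ c q₁ + suc t * direction c) t≡τ)))))
                (mod-unique z₂′ (trans z₂′≡ (trans (cong₂ _+_ z₂≡ (cong₂ _*_ b≡ b≡))
                  (trans (line-step (start₂ c q₂) (toℕ t) (direction c * direction c))
                    (cong (λ t → start₂ c q₂ + suc t * (direction c * direction c)) t≡τ))))))
            where
            at : ∀ {t z₁ z₂} t″ → t ≡ t″ mod suc ℓ → z₁ ≡ position₁ i t″ mod Z →
                 z₂ ≡ position₂ i t″ mod Z → inj₁ (t , x , y , z₁ , z₂) ≡ node i t″ (toℕ x)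
            at t″ t≡ z₁≡ z₂≡ = cong inj₁ (cong₂ _,_ t≡ (cong₂ _,_ (mod-unique x refl)
              (cong₂ _,_ (mod-unique y y≡) (cong₂ _,_ z₁≡ z₂≡))))
        Φ-close (inj₁ (t , x , y , z₁ , z₂)) (inj₂ (x , y , c′ , q₁′ , q₂′ , j))
          (t≡ , refl , refl , z₁≡ , z₂≡ , j≡) _
          rewrite t≡ | z₁≡ | z₂≡ | j≡ =
            ℤ.≤-trans (ℤ.i⊓j≤i _ (entry ℤ.+ L ℤ.* ℤ.+ κ (toℕ c′))) (ℤ.≤-reflexive (p+L*1 out)) ,
            ⊓-glb-+L (out ℤ.+ L ℤ.* ℤ.+ 1) (entry ℤ.+ L ℤ.* ℤ.+ κ (toℕ c′))
              (ℤ.≤-trans (ℤ.≤-reflexive (sym (p+L*0 out))) (+L-step out (z≤n {2})))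
              (ℤ.≤-trans (proj₂ close) (+L-step entry ≤-refl))
          where
          out entry : ℤ
          out = exit x y c′ q₁′ q₂′
          entry = enter x y c′ q₁′ q₂′
          close : Close (L ℤ.* ℤ.+ suc (κ (toℕ c′))) out entry
          close = link-close (toℕ x) (toℕ y) (toℕ c′) (direction c′) (start₁ c′ q₁′) (start₂ c′ q₂′)
            (Fin.toℕ<n c′) (compatible c′ q₁′ q₂′)
        Φ-close (inj₂ (x , y , c′ , q₁′ , q₂′ , j)) (inj₂ (x , y , c′ , q₁′ , q₂′ , j′))
          (refl , refl , refl , refl , refl , j′≡) _
          rewrite j′≡ =
            ⊓-glb-+L (out ℤ.+ L ℤ.* ℤ.+ suc (toℕ j)) (entry ℤ.+ L ℤ.* ℤ.+ (k ∸ toℕ j))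
              (ℤ.≤-trans (ℤ.i⊓j≤i _ (entry ℤ.+ L ℤ.* ℤ.+ (k ∸ suc (toℕ j)))) (+L-step out ≤-refl))
              (ℤ.≤-trans (ℤ.i⊓j≤j (out ℤ.+ L ℤ.* ℤ.+ suc (suc (toℕ j))) _)
                (+L-step entry (≤-trans (∸-monoʳ-≤ k (n≤1+n (toℕ j))) (n≤1+n _)))) ,
            ⊓-glb-+L (out ℤ.+ L ℤ.* ℤ.+ suc (suc (toℕ j))) (entry ℤ.+ L ℤ.* ℤ.+ (k ∸ suc (toℕ j)))
              (ℤ.≤-trans (ℤ.i⊓j≤i _ (entry ℤ.+ L ℤ.* ℤ.+ (k ∸ toℕ j)))
                (+L-step out (≤-trans (n≤1+n _) (n≤1+n _))))
              (ℤ.≤-trans (ℤ.i⊓j≤j (out ℤ.+ L ℤ.* ℤ.+ suc (toℕ j)) _)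
                (+L-step entry (∸-suc k (toℕ j))))
          where
          k : ℕ
          k = κ (toℕ c′)
          out entry : ℤ
          out = exit x y c′ q₁′ q₂′
          entry = enter x y c′ q₁′ q₂′
          -- With truncated subtraction the estimate also covers the slots past the end of the link.
          ∸-suc : ∀ m n → m ∸ n ≤ suc (m ∸ suc n)
          ∸-suc zero    n       = ≤-trans (≤-reflexive (0∸n≡0 n)) z≤n
          ∸-suc (suc m) zero    = ≤-refl
          ∸-suc (suc m) (suc n) = ∸-suc m n
        Φ-close (inj₂ (x , y , c′ , q₁′ , q₂′ , j)) (inj₁ (t , x′ , y′ , z₁ , z₂))
          (j≡ , t≡ , x′≡ , y′≡ , z₁≡ , z₂≡) _
          rewrite t≡ | x′≡ | y′≡ | z₁≡ | z₂≡ | sym j≡ | m+n∸n≡m 1 (toℕ j) =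
            ⊓-glb-+L (out ℤ.+ L ℤ.* ℤ.+ suc (toℕ j)) (entry ℤ.+ L ℤ.* ℤ.+ 1)
              (ℤ.≤-trans (proj₁ close) (ℤ.≤-reflexive (trans (cong (λ k → out ℤ.+ L ℤ.* ℤ.+ suc k) (sym j≡))
                (grow (suc (toℕ j)) out))))
              (ℤ.≤-trans (ℤ.≤-reflexive (sym (p+L*0 entry))) (+L-step entry (z≤n {2}))) ,
            ℤ.≤-trans (ℤ.i⊓j≤j (out ℤ.+ L ℤ.* ℤ.+ suc (toℕ j)) _) (ℤ.≤-reflexive (p+L*1 entry))
          where
          out entry : ℤ
          out = exit x y c′ q₁′ q₂′
          entry = enter x y c′ q₁′ q₂′
          close : Close (L ℤ.* ℤ.+ suc (κ (toℕ c′))) out entry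
          close = link-close (toℕ x) (toℕ y) (toℕ c′) (direction c′) (start₁ c′ q₁′) (start₂ c′ q₂′)
            (Fin.toℕ<n c′) (compatible c′ q₁′ q₂′)

        Unmarked : Set
        Unmarked = ∀ x → Graph.Adj H (vertex i (τ x) x) (vertex i (suc (τ x)) x) → β (suc x) ≡ β x

        Φ-edge : Unmarked → ∀ {u v} → Graph.Adj H u v → Φ (decode v) ℤ.≤ Φ (decode u) ℤ.+ L
        Φ-edge unmarked {u} {v} e with H⊆G e
        ... | inj₁ st = proj₁ (Φ-close (decode u) (decode v) st λ x u≡ v≡ →
          unmarked x (subst₂ (Graph.Adj H) (encoded u≡) (encoded v≡) e))
        ... | inj₂ st = proj₂ (Φ-close (decode v) (decode u) st λ x v≡ u≡ →
          unmarked x (subst₂ (Graph.Adj H) (encoded v≡) (encoded u≡) (Graph.symmetric H e)))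

        Φ-walk : Unmarked → ∀ {u v k} → Walk H u v k → Φ (decode v) ℤ.≤ Φ (decode u) ℤ.+ L ℤ.* ℤ.+ k
        Φ-walk unmarked {u} nil = ℤ.≤-reflexive (sym (p+L*0 (Φ (decode u))))
        Φ-walk unmarked {u} {v} (cons {v = w} {k = k} e p) =
          ℤ.≤-trans (Φ-walk unmarked p) (ℤ.≤-trans (ℤ.+-monoˡ-≤ (L ℤ.* ℤ.+ k) (Φ-edge unmarked e))
            (ℤ.≤-reflexive (identity (Φ (decode u)) L (ℤ.+ k))))
          where
          identity : ∀ p l k → (p ℤ.+ l) ℤ.+ l ℤ.* k ≡ p ℤ.+ l ℤ.* (ℤ.1ℤ ℤ.+ k)
          identity = ℤ.solve-∀

        base-line : ∀ t x → base t x (row i x) ≡ ℤ.+ (x * period (toℕ c) + t)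
        base-line t x = trans
          (cong₂ (λ m n → m ℤ.+ (ℤ.+ 2 ℤ.* S ℤ.* G) ℤ.* ((ℤ.+ toℕ y₀ ℤ.+ n) ℤ.- (ℤ.+ toℕ y₀ ℤ.+ G ℤ.* ℤ.+ x))
                          ℤ.+ ℤ.+ t)
                 (sym (ℤ.pos-* x (period (toℕ c)))) (ℤ.pos-* (toℕ c) x))
          (identity (ℤ.+ (x * period (toℕ c))) (ℤ.+ toℕ y₀) S G (ℤ.+ x) (ℤ.+ t))
          where
          identity : ∀ m y s g x t →
            m ℤ.+ (ℤ.+ 2 ℤ.* s ℤ.* g) ℤ.* ((y ℤ.+ g ℤ.* x) ℤ.- (y ℤ.+ g ℤ.* x)) ℤ.+ t ≡ m ℤ.+ t
          identity = ℤ.solve-∀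

        excess-line : ∀ t x z₁ z₂ → excess t x (row i x) z₁ z₂ ≡ gadgetExcess t x z₁ z₂
        excess-line t x z₁ z₂ with onLine? x (row i x)
        ... | yes _  = refl
        ... | no off = contradiction refl off

        Φ-node : ∀ {t x} → t ≤ ℓ → x < X → Φ (node i t x) ≡
                 L ℤ.* ℤ.+ (x * period (toℕ c) + t) ℤ.+ gadgetExcess t x (position₁ i t) (position₂ i t)
        Φ-node {t} {x} t≤ℓ x<X
          rewrite toℕ-mod {t} {suc ℓ} (s≤s t≤ℓ) | toℕ-mod {x} {X} x<X | toℕ-mod {row i x} {Y₂} (row<Y₂ i x<X)
                | toℕ-mod {position₁ i t} {Z} (position₁<Z i t≤ℓ)
                | toℕ-mod {position₂ i t} {Z} (position₂<Z i t≤ℓ) =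
          cong₂ (λ m n → L ℤ.* m ℤ.+ n) (base-line t x) (excess-line t x _ _)

        -- `Φ` is 0 at the source and Λ · `lineLength` + `β X` at the target, and it grows by at
        -- most `Λ` per edge. Division by `Λ` gives the bound.
        walk-long : Unmarked → β 0 ≡ 0 → ∀ {e k} → Λ * e ≤ β X →
                    Walk H (source i) (target i) k → lineLength i + e ≤ k
        walk-long unmarked β0≡0 {e} {k} Λe≤β p = *-cancelˡ-≤ Λ {{Λ≢0}} (ℤ.drop‿+≤+ (begin
          ℤ.+ (Λ * (lineLength i + e))
            ≡⟨ cong ℤ.+_ (*-distribˡ-+ Λ (lineLength i) e) ⟩
          ℤ.+ (Λ * lineLength i) ℤ.+ ℤ.+ (Λ * e)
            ≤⟨ ℤ.+-mono-≤ (ℤ.≤-reflexive (ℤ.pos-* Λ (lineLength i))) (ℤ.+≤+ Λe≤β) ⟩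
          L ℤ.* ℤ.+ lineLength i ℤ.+ ℤ.+ β X
            ≡⟨ cong (λ m → L ℤ.* ℤ.+ lineLength i ℤ.+ m) (gadgetExcess-out X′) ⟨
          L ℤ.* ℤ.+ lineLength i ℤ.+ gadgetExcess ℓ X′ (position₁ i ℓ) (position₂ i ℓ)
            ≡⟨ Φ-node ≤-refl (n<1+n X′) ⟨
          Φ (node i ℓ X′)
            ≡⟨ cong Φ (decode-encode (node i ℓ X′)) ⟨
          Φ (decode (target i))
            ≤⟨ Φ-walk unmarked p ⟩
          Φ (decode (source i)) ℤ.+ L ℤ.* ℤ.+ k
            ≡⟨ cong (λ m → m ℤ.+ L ℤ.* ℤ.+ k) at-source ⟩
          ℤ.0ℤ ℤ.+ L ℤ.* ℤ.+ k
            ≡⟨ ℤ.+-identityˡ (L ℤ.* ℤ.+ k) ⟩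
          L ℤ.* ℤ.+ k
            ≡⟨ ℤ.pos-* Λ k ⟨
          ℤ.+ (Λ * k) ∎))
          where
          open ℤ.≤-Reasoning
          Λ≢0 : NonZero Λ
          Λ≢0 = >-nonZero (≤-trans (≤-<-trans z≤n (direction<K c)) (m≤n+m K (K * K)))
          at-source : Φ (decode (source i)) ≡ ℤ.0ℤ
          at-source = trans (cong Φ (decode-encode (node i 0 0))) (trans (Φ-node z≤n (s≤s z≤n))
            (cong₂ ℤ._+_ (ℤ.*-zeroʳ L) (trans
              (cong₂ (gadgetExcess 0 0) (+-identityʳ (start₁ c q₁)) (+-identityʳ (start₂ c q₂)))
              (trans (gadgetExcess-in 0) (cong ℤ.+_ β0≡0)))))

      -- Disjointness of the lines, and the demand pairs.

      node-injective : ∀ {i i′ t t′ x x′} → t ≤ ℓ → t′ ≤ ℓ → x < X → x′ < X → node i t x ≡ node i′ t′ x′ →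
        t ≡ t′ × x ≡ x′ × row i x ≡ row i′ x′ ×
        position₁ i t ≡ position₁ i′ t′ × position₂ i t ≡ position₂ i′ t′
      node-injective {i} {i′} {t} {t′} {x} {x′} t≤ℓ t′≤ℓ x<X x′<X eq =
        mod-injective (s≤s t≤ℓ) (s≤s t′≤ℓ) (cong proj₁ components) ,
        mod-injective x<X x′<X (cong (proj₁ ∘ proj₂) components) ,
        mod-injective (row<Y₂ i x<X) (row<Y₂ i′ x′<X) (cong (proj₁ ∘ proj₂ ∘ proj₂) components) ,
        mod-injective (position₁<Z i t≤ℓ) (position₁<Z i′ t′≤ℓ)
          (cong (proj₁ ∘ proj₂ ∘ proj₂ ∘ proj₂) components) ,
        mod-injective (position₂<Z i t≤ℓ) (position₂<Z i′ t′≤ℓ)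
          (cong (proj₂ ∘ proj₂ ∘ proj₂ ∘ proj₂) components)
        where
        components = inj₁-injective eq
        mod-injective : ∀ {m m′ n} .{{_ : NonZero n}} → m < n → m′ < n → m mod n ≡ m′ mod n → m ≡ m′
        mod-injective m<n m′<n eq = trans (sym (toℕ-mod m<n)) (trans (cong toℕ eq) (toℕ-mod m′<n))

      combine-toℕ-injective : ∀ {m n} {i i′ : Fin m} {j j′ : Fin n} →
        toℕ (combine i j) ≡ toℕ (combine i′ j′) → i ≡ i′ × j ≡ j′
      combine-toℕ-injective {i = i} {i′} {j} {j′} eq =
        Fin.combine-injective i j i′ j′ (Fin.toℕ-injective eq)

      colour-injective : ∀ {c c′} → direction c ≡ direction c′ →
        residue₁ c ≡ residue₁ c′ → residue₂ c ≡ residue₂ c′ → c ≡ c′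
      colour-injective {c} {c′} d≡ r₁≡ r₂≡ = trans (sym (recombine c))
        (trans (cong₂ combine (Fin.toℕ-injective d≡) (cong₂ combine r₁≡ r₂≡)) (recombine c′))
        where
        recombine : ∀ c → combine (proj₁ (remQuot {K} (R * R) c)) (combine (residue₁ c) (residue₂ c)) ≡ c
        recombine c = trans (cong (combine (proj₁ (remQuot {K} (R * R) c)))
          (Fin.combine-remQuot {R} R (proj₂ (remQuot {K} (R * R) c))))
          (Fin.combine-remQuot {K} (R * R) c)

      -- Two consecutive vertices determine the line: their difference gives the direction, going
      -- back `t` steps gives the starts and residues, hence the colour. The colour is the slope,
      -- which gives the first row. So lines share no gadget edge.
      edge-injective : ∀ {i i′ t t′ x x′} → t < ℓ → t′ < ℓ → x < X → x′ < X →
        vertex i t x ≡ vertex i′ t′ x′ → vertex i (suc t) x ≡ vertex i′ (suc t′) x′ →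
        (i , x) ≡ (i′ , x′) × t ≡ t′
      edge-injective {y₀ , c , q₁ , q₂} {y₀′ , c′ , q₁′ , q₂′} {t} {t′} {x} {x′} t<ℓ t′<ℓ x<X x′<X eq eq⁺
        with refl , refl , r≡ , p₁≡ , p₂≡ ← node-injective (<⇒≤ t<ℓ) (<⇒≤ t′<ℓ) x<X x′<X (encode-injective eq)
           | _ , _ , _ , p₁⁺≡ , _ ← node-injective t<ℓ t′<ℓ x<X x′<X (encode-injective eq⁺)
        = cong₂ _,_ (cong₂ _,_ y₀≡ (cong₂ _,_ c≡ (cong₂ _,_ (proj₁ q₁≡) (proj₁ q₂≡)))) refl , refl
        where
        d≡ : direction c ≡ direction c′
        d≡ = +-cancelˡ-≡ (start₁ c q₁ + t * direction c) _ _
          (trans (line-step (start₁ c q₁) t (direction c)) (trans p₁⁺≡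
            (trans (sym (line-step (start₁ c′ q₁′) t (direction c′))) (cong (_+ direction c′) (sym p₁≡)))))
        q₁≡ : q₁ ≡ q₁′ × residue₁ c ≡ residue₁ c′
        q₁≡ = combine-toℕ-injective (+-cancelʳ-≡ (t * direction c) _ _
          (trans p₁≡ (cong (λ d → start₁ c′ q₁′ + t * d) (sym d≡))))
        q₂≡ : q₂ ≡ q₂′ × residue₂ c ≡ residue₂ c′
        q₂≡ = combine-toℕ-injective (+-cancelʳ-≡ (t * (direction c * direction c)) _ _
          (trans p₂≡ (cong (λ d → start₂ c′ q₂′ + t * (d * d)) (sym d≡))))
        c≡ : c ≡ c′
        c≡ = colour-injective d≡ (proj₂ q₁≡) (proj₂ q₂≡)
        y₀≡ : y₀ ≡ y₀′
        y₀≡ = Fin.toℕ-injective (+-cancelʳ-≡ (toℕ c * x) _ _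
          (trans r≡ (cong (λ c → toℕ y₀′ + toℕ c * x) (sym c≡))))

      -- The source reveals the first row and both start indices. The rows at the two ends differ by
      -- the slope times `X′`, which reveals the colour once there are two columns.
      ends-injective : 1 ≤ X′ → ∀ {i i′} → (source i , target i) ≡ (source i′ , target i′) → i ≡ i′
      ends-injective 1≤X′ {y₀ , c , q₁ , q₂} {y₀′ , c′ , q₁′ , q₂′} eq
        with _ , _ , r≡ , p₁≡ , p₂≡ ← node-injective {y₀ , c , q₁ , q₂} {y₀′ , c′ , q₁′ , q₂′} z≤n z≤n
               (s≤s z≤n) (s≤s z≤n) (encode-injective (cong proj₁ eq))
           | _ , _ , r⁺≡ , _ ← node-injective {y₀ , c , q₁ , q₂} {y₀′ , c′ , q₁′ , q₂′} ≤-refl ≤-refl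
               ≤-refl ≤-refl (encode-injective (cong proj₂ eq))
        = cong₂ _,_ y₀≡ (cong₂ _,_ c≡ (cong₂ _,_
            (proj₁ (combine-toℕ-injective (+-cancelʳ-≡ 0 _ _ p₁≡)))
            (proj₁ (combine-toℕ-injective (+-cancelʳ-≡ 0 _ _ p₂≡)))))
        where
        y₀≡ : y₀ ≡ y₀′
        y₀≡ = Fin.toℕ-injective (+-cancelʳ-≡ 0 _ _
          (trans (cong (toℕ y₀ +_) (sym (*-zeroʳ (toℕ c)))) (trans r≡ (cong (toℕ y₀′ +_) (*-zeroʳ (toℕ c′))))))
        c≡ : c ≡ c′
        c≡ = Fin.toℕ-injective (*-cancelʳ-≡ _ _ X′ {{>-nonZero 1≤X′}}
          (+-cancelˡ-≡ (toℕ y₀) _ _ (trans r⁺≡ (cong (λ y → toℕ y + toℕ c′ * X′) (sym y₀≡)))))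

      lines : List Line
      lines = cartesianProduct (allFin Y) (cartesianProduct (allFin M) (cartesianProduct (allFin g) (allFin g)))

      lines-unique : Unique lines
      lines-unique = cartesianProduct⁺ (allFin⁺ Y) (cartesianProduct⁺ (allFin⁺ M)
        (cartesianProduct⁺ (allFin⁺ g) (allFin⁺ g)))

      ∈-lines : ∀ i → i ∈ lines
      ∈-lines (y₀ , c , q₁ , q₂) = ∈-cartesianProduct⁺ (∈-allFin y₀) (∈-cartesianProduct⁺ (∈-allFin c)
        (∈-cartesianProduct⁺ (∈-allFin q₁) (∈-allFin q₂)))

      length-allFin : ∀ n → length (allFin n) ≡ n
      length-allFin n = length-tabulate (λ (i : Fin n) → i)

      length-lines : length lines ≡ Y * (M * (g * g))
      length-lines = trans (length-cartesianProduct (allFin Y) _) (cong₂ _*_ (length-allFin Y)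
        (trans (length-cartesianProduct (allFin M) _) (cong₂ _*_ (length-allFin M)
          (trans (length-cartesianProduct (allFin g) _) (cong₂ _*_ (length-allFin g) (length-allFin g))))))

      demands : 1 ≤ X′ → DemandSet order
      demands 1≤X′ = record
        { pairs  = map (λ i → source i , target i) lines
        ; unique = map⁺ (ends-injective 1≤X′) lines-unique
        }

      ∣demands∣ : ∀ 1≤X′ → ∣ demands 1≤X′ ∣ ≡ Y * (M * (g * g))
      ∣demands∣ 1≤X′ = trans (length-map (λ i → source i , target i) lines) length-lines

      -- Counting the edges of a spanner.

      module Spanner (1≤s : 1 ≤ s) (1≤ℓ : 1 ≤ ℓ) (Q≤R : Q ≤ R) (H : Graph order) (H⊆G : H ⊆ᴳ graph) where
        open Graph H using (Adj; adj?)

        Broken : Line → ℕ → Set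
        Broken i x = ∃ λ t → t < ℓ × ¬ Adj (vertex i t x) (vertex i (suc t) x)

        broken? : ∀ i x → Dec (Broken i x)
        broken? i = λ x → anyUpTo? (λ t → ¬? (adj? (vertex i t x) (vertex i (suc t) x))) ℓ

        -- `downFrom (suc x)` has `x` in front, so consecutive counts differ by the test at `x`
        -- alone.
        brokenCount : Line → ℕ → ℕ
        brokenCount i x = length (filter (broken? i) (downFrom x))

        β τ : Line → ℕ → ℕ
        β i x = brokenCount i x ⊓ Q
        τ i x with broken? i x
        ... | yes (t , _) = t
        -- In an unbroken gadget `β` does not jump, and any layer below `ℓ` will do.
        ... | no  _       = 0

        τ<ℓ : ∀ i x → τ i x < ℓ
        τ<ℓ i x with broken? i x
        ... | yes (_ , t<ℓ , _) = t<ℓ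
        ... | no  _             = 1≤ℓ

        β-mono : ∀ i x → β i x ≤ β i (suc x)
        β-mono i x with broken? i x
        ... | yes _ = ⊓-monoˡ-≤ Q (n≤1+n (brokenCount i x))
        ... | no  _ = ≤-refl

        β-step : ∀ i x → β i (suc x) ≤ suc (β i x)
        β-step i x with broken? i x
        ... | yes _ = ⊓-monoʳ-≤ (suc (brokenCount i x)) (n≤1+n Q)
        ... | no  _ = n≤1+n (β i x)

        unmarked : ∀ i x → Adj (vertex i (τ i x) x) (vertex i (suc (τ i x)) x) → β i (suc x) ≡ β i x
        unmarked i x e with broken? i x
        ... | yes (_ , _ , ¬e) = contradiction e ¬e
        ... | no  _            = refl

        -- At the last column `β` has reached its cap `Q` = Λs, which is worth `s` edges.
        walk-long-broken : ∀ i → Q ≤ brokenCount i X → ∀ {k} → Walk H (source i) (target i) k →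
                           lineLength i + s ≤ k
        walk-long-broken i Q≤broken = LowerBound.walk-long 1≤s Q≤R i (τ i) (β i) (τ<ℓ i)
          (λ x → m⊓n≤n (brokenCount i x) Q) (β-mono i) (β-step i) H H⊆G (unmarked i) refl
          (⊓-glb Q≤broken ≤-refl)

        sound? : (ix : Line × ℕ) → Dec (¬ Broken (proj₁ ix) (proj₂ ix))
        sound? (i , x) = ¬? (broken? i x)

        soundCrossings : List (Line × ℕ)
        soundCrossings = filter sound? (cartesianProduct lines (downFrom X))

        edgeOf : (Line × ℕ) × ℕ → Fin order × Fin order
        edgeOf ((i , x) , t) = vertex i t x , vertex i (suc t) x

        ∈-soundCrossings⁻ : ∀ {i x t} → ((i , x) , t) ∈ cartesianProduct soundCrossings (downFrom ℓ) →
                            t < ℓ × x < X × ¬ Broken i x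
        ∈-soundCrossings⁻ p =
          let p₁ , p₂ = ∈-cartesianProduct⁻ soundCrossings (downFrom ℓ) p
              p₃ , ¬broken = ∈-filter⁻ sound? {xs = cartesianProduct lines (downFrom X)} p₁
              _ , p₄ = ∈-cartesianProduct⁻ lines (downFrom X) p₃
          in ∈-downFrom⁻ p₂ , ∈-downFrom⁻ p₄ , ¬broken

        -- A sound crossing has all its `ℓ` edges in `H`, and different crossings share none by
        -- `edge-injective`.
        soundCrossings≤edgeCount : length soundCrossings * ℓ ≤ edgeCount H
        soundCrossings≤edgeCount = ≤-trans
          (≤-reflexive (sym (trans (length-cartesianProduct soundCrossings (downFrom ℓ))
            (cong (length soundCrossings *_) (length-downFrom ℓ)))))
          (length-injection edgeOf
            (cartesianProduct⁺ (filter⁺ sound? (cartesianProduct⁺ lines-unique (downFrom⁺ X))) (downFrom⁺ ℓ))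
            into inj)
          where
          edge? : ∀ (e : Fin order × Fin order) → Dec (proj₁ e Fin.< proj₂ e × Adj (proj₁ e) (proj₂ e))
          edge? (u , v) = (u Fin.<? v) ×-dec adj? u v
          into : ∀ {e} → e ∈ cartesianProduct soundCrossings (downFrom ℓ) →
                 edgeOf e ∈ filter edge? (cartesianProduct (allFin order) (allFin order))
          into {(i , x) , t} p =
            let t<ℓ , _ , ¬broken = ∈-soundCrossings⁻ p in
            ∈-filter⁺ edge? (∈-cartesianProduct⁺ (∈-allFin (vertex i t x)) (∈-allFin (vertex i (suc t) x)))
              ( encode-< _ _ (subst₂ _<_ (sym (toℕ-mod (m<n⇒m<1+n t<ℓ))) (sym (toℕ-mod (s≤s t<ℓ))) (n<1+n t))
              , decidable-stable (adj? _ _) λ ¬e → ¬broken (t , t<ℓ , ¬e))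
          inj : ∀ {e e′} → e ∈ cartesianProduct soundCrossings (downFrom ℓ) →
                e′ ∈ cartesianProduct soundCrossings (downFrom ℓ) → edgeOf e ≡ edgeOf e′ → e ≡ e′
          inj {(i , x) , t} {(i′ , x′) , t′} p p′ eq =
            let t<ℓ , x<X , _ = ∈-soundCrossings⁻ p ; t′<ℓ , x′<X , _ = ∈-soundCrossings⁻ p′
                ix≡ , t≡ = edge-injective {i} {i′} t<ℓ t′<ℓ x<X x′<X (cong proj₁ eq) (cong proj₂ eq)
            in cong₂ _,_ ix≡ t≡

        edgeCount-large : (∀ i → brokenCount i X ≤ Q) → Y * (M * (g * g)) * (X ∸ Q) * ℓ ≤ edgeCount H
        edgeCount-large few = ≤-trans (*-monoˡ-≤ ℓ (≤-trans
          (≤-reflexive (cong (_* (X ∸ Q)) (sym length-lines)))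
          (length-filter-cartesianProduct sound? lines (downFrom X) λ {i} _ → m≤n+o⇒m∸n≤o X Q (begin
            X
              ≡⟨ length-downFrom X ⟨
            length (downFrom X)
              ≡⟨ length-filter-∁ (broken? i) (downFrom X) ⟨
            brokenCount i X + length (filter (¬? ∘ broken? i) (downFrom X))
              ≤⟨ +-monoˡ-≤ _ (few i) ⟩
            Q + length (filter (¬? ∘ broken? i) (downFrom X)) ∎))))
          soundCrossings≤edgeCount
          where open ≤-Reasoning

        -- Either some line is broken in `Q` columns and therefore long, or every line is sound in
        -- at least `X ∸ Q` columns, which takes more edges than `H` has.
        stretched : edgeCount H < Y * (M * (g * g)) * (X ∸ Q) * ℓ →
                    ∃ λ i → ∀ {k} → Walk H (source i) (target i) k → lineLength i + s ≤ k
        stretched sparse with any? (λ i → Q ≤? brokenCount i X) lines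
        ... | yes some = let i , _ , Q≤broken = find some in i , walk-long-broken i Q≤broken
        ... | no  none = contradiction (edgeCount-large λ i → ≰⇒≥ λ Q≤broken → none (lose (∈-lines i) Q≤broken))
                                       (<⇒≱ sparse)

      -- With `β` = 0 the lower bound applies to the whole graph and meets the length of the walk
      -- along the line.
      distance-line : 1 ≤ s → 1 ≤ ℓ → Q ≤ R → ∀ i → Dist graph (source i) (target i) [ lineLength i ]
      distance-line 1≤s 1≤ℓ Q≤R i = connected (walk-line i 1≤s X′ ≤-refl) λ p →
        ≤-trans (≤-reflexive (sym (+-identityʳ (lineLength i))))
          (LowerBound.walk-long 1≤s Q≤R i (λ _ → 0) (λ _ → 0) (λ _ → 1≤ℓ) (λ _ → z≤n) (λ _ → z≤n)
            (λ _ → z≤n) graph (λ e → e) (λ _ _ → refl) refl (≤-reflexive (*-zeroʳ Λ)) p)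

-- Real and rational constants against natural numbers.

module Rationals where
  open import Defs
  open import Data.Nat as ℕ using (ℕ; suc; z≤n)
  open import Data.Integer as ℤ using (ℤ; +_)
  import Data.Integer.Properties as ℤ
  import Data.Nat.Properties as ℕ
  open import Data.Nat.Coprimality using (sym; 1-coprimeTo)
  open import Data.Product using (Σ-syntax; _×_; _,_)
  open import Data.Rational hiding (truncate)
  open import Data.Rational.Properties
  open import Data.Rational.Solver
  open import Function.Bundles using (Equivalence)
  open import Relation.Binary.PropositionalEquality hiding (sym; [_])
  import Relation.Binary.PropositionalEquality as ≡
  open import Relation.Nullary.Construct.Add.Supremum using ([_])

  fromℕ≡mkℚ : ∀ m → fromℕ m ≡ mkℚ (+ m) 0 (sym (1-coprimeTo m))
  fromℕ≡mkℚ m = normalize-coprime (sym (1-coprimeTo m))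

  fromℕ-* : ∀ m n → fromℕ (m ℕ.* n) ≡ fromℕ m * fromℕ n
  fromℕ-* m n = ≡.sym (trans (cong₂ _*_ (fromℕ≡mkℚ m) (fromℕ≡mkℚ n))
                             (cong (_/ 1) (≡.sym (ℤ.pos-* m n))))

  fromℕ-+ : ∀ m n → fromℕ (m ℕ.+ n) ≡ fromℕ m + fromℕ n
  fromℕ-+ m n = ≡.sym (trans (cong₂ _+_ (fromℕ≡mkℚ m) (fromℕ≡mkℚ n))
    (cong (_/ 1) (cong₂ ℤ._+_ (ℤ.*-identityʳ (+ m)) (ℤ.*-identityʳ (+ n)))))

  fromℕ-mono : ∀ {m n} → m ℕ.≤ n → fromℕ m ≤ fromℕ n
  fromℕ-mono {m} {n} m≤n = subst₂ _≤_ (≡.sym (fromℕ≡mkℚ m)) (≡.sym (fromℕ≡mkℚ n))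
    (*≤* (ℤ.*-monoʳ-≤-nonNeg (+ 1) (ℤ.+≤+ m≤n)))

  fromℕ-cancel : ∀ {m n} → fromℕ m ≤ fromℕ n → m ℕ.≤ n
  fromℕ-cancel {m} {n} m≤n with subst₂ _≤_ (fromℕ≡mkℚ m) (fromℕ≡mkℚ n) m≤n
  ... | *≤* m*1≤n*1 = ℤ.drop‿+≤+ (ℤ.*-cancelʳ-≤-pos (+ m) (+ n) (+ 1) m*1≤n*1)

  fromℕ-nonNeg : ∀ m → NonNegative (fromℕ m)
  fromℕ-nonNeg m = nonNegative (fromℕ-mono (z≤n {m}))

  fromℕ-pos : ∀ {m} → 1 ℕ.≤ m → Positive (fromℕ m)
  fromℕ-pos {suc m} _ = subst Positive (≡.sym (fromℕ≡mkℚ (suc m))) _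

  ≤-fromℕ : ∀ q → q ≤ fromℕ (suc ℤ.∣ ↥ q ∣)
  ≤-fromℕ q@(mkℚ n d _) = subst (q ≤_) (≡.sym (fromℕ≡mkℚ (suc ℤ.∣ n ∣))) (*≤* (begin
    n ℤ.* + 1                 ≡⟨ ℤ.*-identityʳ n ⟩
    n                         ≤⟨ i≤∣i∣ n ⟩
    + ℤ.∣ n ∣                   ≤⟨ ℤ.+≤+ (ℕ.≤-trans (ℕ.n≤1+n ℤ.∣ n ∣) (ℕ.m≤m*n (suc ℤ.∣ n ∣) (suc d))) ⟩
    + (suc ℤ.∣ n ∣ ℕ.* suc d)   ≡⟨ ℤ.pos-* (suc ℤ.∣ n ∣) (suc d) ⟩
    + suc ℤ.∣ n ∣ ℤ.* + suc d   ∎))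
    where
    open ℤ.≤-Reasoning
    i≤∣i∣ : ∀ i → i ℤ.≤ + ℤ.∣ i ∣
    i≤∣i∣ (+ n)      = ℤ.≤-refl
    i≤∣i∣ ℤ.-[1+ n ] = ℤ.-≤+

  module _ (x : ℝ) where
    open ℝ x

    lower≤upper : ∀ {r q} → Lower r → Upper q → r ≤ q
    lower≤upper {r} {q} r<x x<q = ≮⇒≥ λ q<r →
      disjoint r (r<x , Equivalence.from (upperRounded r) (q , q<r , x<q))

    -- A natural number above `x` may replace `x` throughout: it allows more edges and demands more
    -- distortion, so it gives the stronger claim.
    module _ {q} C (x<q : Upper q) (q≤C : q ≤ fromℕ C) where

      ≤·⇒≤* : ∀ {m n} → m ≤ x · n → m ℕ.≤ C ℕ.* n
      ≤·⇒≤* {m} {n} m≤xn = fromℕ-cancel (≤-trans (m≤xn q x<q)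
        (≤-trans (*-monoʳ-≤-nonNeg (fromℕ n) {{fromℕ-nonNeg n}} q≤C) (≤-reflexive (≡.sym (fromℕ-* C n)))))

      +≤⇒+≤∞ : ∀ {d e} → d ℕ.+ C ℕ.≤ e → d + x ≤∞ [ e ]
      +≤⇒+≤∞ {d} {e} d+C≤e r r<x = ≤-trans
        (+-monoʳ-≤ (fromℕ d) (≤-trans (lower≤upper r<x x<q) q≤C))
        (≤-trans (≤-reflexive (≡.sym (fromℕ-+ d C))) (fromℕ-mono d+C≤e))

  -- Meant for n = Ak² and |P| = Bk. The choice a = 1/A works since a²n = k²/A ≤ k² ≤ (Bk)².
  √-lower : ∀ A {B} → 1 ℕ.≤ A → 1 ℕ.≤ B →
    Σ[ a ∈ ℚ ] (0ℚ < a × (∀ k → a √ (A ℕ.* (k ℕ.* k)) ≤ (B ℕ.* k)))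
  √-lower A {B} 1≤A 1≤B = a , positive⁻¹ a {{a>0}} , bound
    where
    instance
      A>0 : Positive (fromℕ A)
      A>0 = fromℕ-pos 1≤A
      A≢0 : NonZero (fromℕ A)
      A≢0 = pos⇒nonZero (fromℕ A)
    a : ℚ
    a = 1/ fromℕ A
    a>0 : Positive a
    a>0 = 1/pos⇒pos (fromℕ A)
    instance
      a²≥0 : NonNegative (a * a)
      a²≥0 = pos⇒nonNeg (a * a) {{pos*pos⇒pos a {{a>0}} a {{a>0}}}}
    bound : ∀ k → a √ (A ℕ.* (k ℕ.* k)) ≤ (B ℕ.* k)
    bound k = begin
      (a * a) * fromℕ (A ℕ.* (k ℕ.* k))
        ≤⟨ *-monoˡ-≤-nonNeg (a * a) (fromℕ-mono
             (ℕ.m≤n*m (A ℕ.* (k ℕ.* k)) A {{ℕ.>-nonZero 1≤A}})) ⟩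
      (a * a) * fromℕ (A ℕ.* (A ℕ.* (k ℕ.* k)))
        ≡⟨ cong ((a * a) *_) (trans (fromℕ-* A _) (cong (fromℕ A *_) (fromℕ-* A _))) ⟩
      (a * a) * (fromℕ A * (fromℕ A * fromℕ (k ℕ.* k)))
        ≡⟨ solve 3 (λ a f e → (a :* a) :* (f :* (f :* e)) := (a :* f) :* ((a :* f) :* e)) refl
             a (fromℕ A) (fromℕ (k ℕ.* k)) ⟩
      (a * fromℕ A) * ((a * fromℕ A) * fromℕ (k ℕ.* k))
        ≡⟨ cong (λ u → u * (u * fromℕ (k ℕ.* k))) (*-inverseˡ (fromℕ A)) ⟩
      1ℚ * (1ℚ * fromℕ (k ℕ.* k))
        ≡⟨ trans (*-identityˡ _) (*-identityˡ _) ⟩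
      fromℕ (k ℕ.* k)
        ≤⟨ fromℕ-mono (ℕ.*-mono-≤ k≤Bk k≤Bk) ⟩
      fromℕ (B ℕ.* k ℕ.* (B ℕ.* k))
        ≡⟨ fromℕ-* (B ℕ.* k) (B ℕ.* k) ⟩
      fromℕ (B ℕ.* k) * fromℕ (B ℕ.* k) ∎
      where
      open ≤-Reasoning
      open +-*-Solver
      k≤Bk : k ℕ.≤ B ℕ.* k
      k≤Bk = ℕ.m≤n*m k B {{ℕ.>-nonZero 1≤B}}

  √-upper : ∀ {A} B → 1 ℕ.≤ A → 1 ℕ.≤ B →
    Σ[ b ∈ ℚ ] (0ℚ < b × (∀ k → (B ℕ.* k) ≤ b √ (A ℕ.* (k ℕ.* k))))
  √-upper {A} B 1≤A 1≤B = fromℕ B , positive⁻¹ (fromℕ B) {{fromℕ-pos 1≤B}} , bound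
    where
    bound : ∀ k → (B ℕ.* k) ≤ fromℕ B √ (A ℕ.* (k ℕ.* k))
    bound k = subst₂ _≤_ (fromℕ-* (B ℕ.* k) (B ℕ.* k))
      (trans (fromℕ-* (B ℕ.* B) _) (cong (_* fromℕ (A ℕ.* (k ℕ.* k))) (fromℕ-* B B)))
      (fromℕ-mono (ℕ.≤-trans (ℕ.≤-reflexive (ℕ.[m*n]*[o*p]≡[m*o]*[n*p] B k B k))
        (ℕ.*-monoʳ-≤ (B ℕ.* B) (ℕ.m≤n*m (k ℕ.* k) A {{ℕ.>-nonZero 1≤A}}))))

-- Choice of the parameters.

module Parametrisation where
  open import Defs using (Graph; _⊆ᴳ_; edgeCount; Walk; Dist; DemandSet; ∣_∣)
  open import Data.List.Membership.Propositional using (_∈_)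
  open import Data.List.Membership.Propositional.Properties using (∈-map⁺)
  open import Data.Nat
  open import Data.Nat.Properties
  open import Data.Nat.Tactic.RingSolver using (solve-∀)
  open import Data.Product using (∃₂; _×_; _,_)
  open import Relation.Binary.PropositionalEquality hiding ([_])
  open import Relation.Nullary.Construct.Add.Supremum using ([_])
  open Potential using (module Parameters)

  -- K makes the gadgets denser than 2C edges per vertex; ℓ is then taken so large
  -- that the interior vertices of the links do not spoil this density.
  record Choice (C : ℕ) : Set where
    field
      K R g ℓ : ℕ
      K≡      : K ≡ 64 * C
      R≡      : R ≡ Parameters.Q K (K * (R * R)) ℓ C
      ℓ-large : 8 * C * (C * (K * (R * R) * (K * (R * R)) + 1) + C * (K * (R * R) * (K * (R * R)))) ≤ ℓ
      g≡      : g ≡ ℓ * (K * K)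
      1≤C     : 1 ≤ C
      1≤K     : 1 ≤ K
      1≤R     : 1 ≤ R
      1≤ℓ     : 1 ≤ ℓ
      1≤g     : 1 ≤ g

  abstract
    choice : ∀ C → 1 ≤ C → Choice C
    choice C 1≤C = record
      { K = K ; R = R ; g = ℓ * (K * K) ; ℓ = ℓ ; K≡ = refl ; R≡ = refl ; ℓ-large = n≤1+n _ ; g≡ = refl
      ; 1≤C = 1≤C ; 1≤K = 1≤K ; 1≤R = *-mono-≤ (≤-trans 1≤K (m≤n+m K (K * K))) 1≤C
      ; 1≤ℓ = s≤s z≤n ; 1≤g = *-mono-≤ (s≤s (z≤n {κ})) (*-mono-≤ 1≤K 1≤K) }
      where
      K R M κ ℓ : ℕ
      K = 64 * C
      -- This is `Q`, which involves only `K` and `C`, so `ℓ` can be chosen after `R` and `M`.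
      R = (K * K + K) * C
      M = K * (R * R)
      κ = 8 * C * (C * (M * M + 1) + C * (M * M))
      ℓ = suc κ
      1≤K : 1 ≤ K
      1≤K = *-mono-≤ (s≤s (z≤n {63})) 1≤C

  -- Both sides are compared with 32 C ℓ X Y (gR)².
  sparse : ∀ {C K R g ℓ κ X Y D Z} → K ≡ 64 * C → 8 * C * κ ≤ ℓ → Z ≤ g * R + g * R → X < D + D →
    1 ≤ C → 1 ≤ R → 1 ≤ g → 1 ≤ ℓ → 1 ≤ Y →
    C * (suc ℓ * (X * ((Y + Y) * (Z * Z))) + X * ((Y + Y) * (K * (R * R) * (g * (g * κ))))) <
    Y * (K * (R * R) * (g * g)) * D * ℓ
  sparse {C} {K} {R} {g} {ℓ} {κ} {X} {Y} {D} {Z} refl κ≤ℓ Z≤ X<2D 1≤C 1≤R 1≤g 1≤ℓ 1≤Y = begin-strict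
    C * (suc ℓ * (X * ((Y + Y) * (Z * Z))) + X * ((Y + Y) * (K * (R * R) * (g * (g * κ)))))
      ≤⟨ *-monoʳ-≤ C (+-monoˡ-≤ _ (*-mono-≤ (+-monoˡ-≤ ℓ 1≤ℓ)
           (*-monoʳ-≤ X (*-monoʳ-≤ (Y + Y) (*-mono-≤ Z≤ Z≤))))) ⟩
    C * ((ℓ + ℓ) * (X * ((Y + Y) * ((g * R + g * R) * (g * R + g * R))))
      + X * ((Y + Y) * (64 * C * (R * R) * (g * (g * κ)))))
      ≡⟨ collect C R g ℓ κ X Y ⟩
    16 * (C * (Y * (R * R * (g * g)))) * (ℓ + 8 * C * κ) * X
      -- The summand `8 * C * κ` stems from the link vertices and is at most `ℓ`, the share of the
      -- gadgets.
      ≤⟨ *-monoˡ-≤ X (*-monoʳ-≤ (16 * (C * (Y * (R * R * (g * g))))) (+-monoʳ-≤ ℓ κ≤ℓ)) ⟩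
    16 * (C * (Y * (R * R * (g * g)))) * (ℓ + ℓ) * X
      <⟨ *-monoʳ-< (16 * (C * (Y * (R * R * (g * g)))) * (ℓ + ℓ)) {{>-nonZero positive}} X<2D ⟩
    16 * (C * (Y * (R * R * (g * g)))) * (ℓ + ℓ) * (D + D)
      ≡⟨ split C R g ℓ Y D ⟩
    Y * (64 * C * (R * R) * (g * g)) * D * ℓ ∎
    where
    open ≤-Reasoning
    collect : ∀ C R g ℓ κ X Y →
      C * ((ℓ + ℓ) * (X * ((Y + Y) * ((g * R + g * R) * (g * R + g * R))))
        + X * ((Y + Y) * (64 * C * (R * R) * (g * (g * κ))))) ≡
      16 * (C * (Y * (R * R * (g * g)))) * (ℓ + 8 * C * κ) * X
    collect = solve-∀
    split : ∀ C R g ℓ Y D →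
      16 * (C * (Y * (R * R * (g * g)))) * (ℓ + ℓ) * (D + D) ≡
      Y * (64 * C * (R * R) * (g * g)) * D * ℓ
    split = solve-∀
    positive : 1 ≤ 16 * (C * (Y * (R * R * (g * g)))) * (ℓ + ℓ)
    positive = *-mono-≤ (*-mono-≤ (s≤s (z≤n {15})) (*-mono-≤ 1≤C (*-mono-≤ 1≤Y
      (*-mono-≤ (*-mono-≤ 1≤R 1≤R) (*-mono-≤ 1≤g 1≤g))))) (≤-trans 1≤ℓ (m≤m+n ℓ ℓ))

  module Family {C : ℕ} (params : Choice C) where
    open Choice params public

    -- With `X` columns there are AX² vertices and BX demand pairs, where `A` and `B` do not depend
    -- on `X`.
    M Z A B : ℕ
    M = K * (R * R)
    Z = g * R + ℓ * (K * K)
    κ : ℕ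
    κ = C * (M * M + 1) + C * (M * M)
    A = (M + M) * (suc ℓ * (Z * Z) + M * (g * (g * κ)))
    B = M * (M * (g * g))

    1≤M : 1 ≤ M
    1≤M = *-mono-≤ 1≤K (*-mono-≤ 1≤R 1≤R)

    1≤Z : 1 ≤ Z
    1≤Z = ≤-trans (*-mono-≤ 1≤g 1≤R) (m≤m+n (g * R) _)

    1≤A : 1 ≤ A
    1≤A = *-mono-≤ (≤-trans 1≤M (m≤m+n M M))
      (≤-trans (*-mono-≤ (s≤s (z≤n {ℓ})) (*-mono-≤ 1≤Z 1≤Z)) (m≤m+n (suc ℓ * (Z * Z)) _))

    1≤B : 1 ≤ B
    1≤B = *-mono-≤ 1≤M (*-mono-≤ 1≤M (*-mono-≤ 1≤g 1≤g))

    module Member (N : ℕ) where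
      X′ X Y : ℕ
      -- `R + R` keeps more than half of the columns after `R` are discarded, `N` makes the order
      -- exceed `N`, and the successor ensures two columns.
      X′ = suc (R + R + N)
      X = suc X′
      -- A line climbs at most `M * X` rows. With as many starting rows the order is quadratic in
      -- `X`, the number of lines linear, and half of all rows are starting rows.
      Y = M * X

      1≤Y : 1 ≤ Y
      1≤Y = *-mono-≤ 1≤M (s≤s (z≤n {X′}))

      Y₂≢0 : NonZero (Y + M * X)
      Y₂≢0 = >-nonZero (≤-trans 1≤Y (m≤m+n Y _))

      Z≢0 : NonZero Z
      Z≢0 = >-nonZero 1≤Z

      open Construction.Gadgets K R g ℓ C X′ Y (Y + M * X) Z {{Y₂≢0}} {{Z≢0}} public hiding (X; M; κ)
      open Bounds ≤-refl ≤-refl public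

      order≡ : order ≡ A * (X * X)
      order≡ = identity (suc ℓ) X M (Z * Z) (M * (g * (g * κ)))
        where
        identity : ∀ l X M z w →
          l * (X * ((M * X + M * X) * z)) + X * ((M * X + M * X) * w) ≡
          (M + M) * (l * z + w) * (X * X)
        identity = solve-∀

      ∣demands∣≡ : ∣ demands (s≤s z≤n) ∣ ≡ B * X
      ∣demands∣≡ = trans (∣demands∣ (s≤s z≤n)) (identity M X (M * (g * g)))
        where
        identity : ∀ M X w → M * X * w ≡ M * w * X
        identity = solve-∀

      N<order : N < order
      N<order = <-≤-trans (≤-trans (s≤s (m≤n+m N (R + R))) (n≤1+n X′))
        (≤-trans (m≤m*n X X) (≤-trans (m≤n*m (X * X) A {{>-nonZero 1≤A}}) (≤-reflexive (sym order≡))))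

      Q≤R : Q ≤ R
      Q≤R = ≤-reflexive (sym R≡)

      long : ∀ {m} → m ≤ C * order → m < Y * (M * (g * g)) * (X ∸ Q) * ℓ
      long m≤ = ≤-<-trans m≤ (sparse K≡ ℓ-large Z≤ X<2D 1≤C 1≤R 1≤g 1≤ℓ 1≤Y)
        where
        Z≤ : Z ≤ g * R + g * R
        -- By the choice of `g`, the drift of a line across a gadget is at most the range `g * R` of
        -- the starts.
        Z≤ = +-monoʳ-≤ (g * R) (≤-trans (≤-reflexive (sym g≡)) (m≤m*n g R {{>-nonZero 1≤R}}))
        X∸Q : X ∸ R ≡ suc (suc (R + N))
        X∸Q = trans (cong (_∸ R) (identity R N)) (m+n∸m≡n R _)
          where
          identity : ∀ R N → suc (suc (R + R + N)) ≡ R + suc (suc (R + N))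
          identity = solve-∀
        X<2D : X < (X ∸ Q) + (X ∸ Q)
        X<2D = subst (λ q → X < (X ∸ q) + (X ∸ q)) R≡ (subst (λ d → X < d + d) (sym X∸Q)
          (≤-trans (m≤m+n (suc X) (suc N)) (≤-reflexive (identity R N))))
          where
          identity : ∀ R N → suc (suc (suc (R + R + N))) + suc N ≡
                     suc (suc (R + N)) + suc (suc (R + N))
          identity = solve-∀

      distorted : (H : Graph order) → H ⊆ᴳ graph → edgeCount H ≤ C * order →
        ∃₂ λ s t → (s , t) ∈ DemandSet.pairs (demands (s≤s z≤n)) ×
        ∃₂ λ d e → Dist graph s t [ d ] × Dist H s t e × (∀ {k} → Walk H s t k → d + C ≤ k)
      distorted H H⊆G few =
        let i , far   = Spanner.stretched 1≤C 1≤ℓ Q≤R H H⊆G (long few)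
            e , distH = Graphs.Distance.distance H (source i) (target i)
        in source i , target i , ∈-map⁺ (λ i → source i , target i) (∈-lines i) ,
           lineLength i , e , distance-line 1≤C 1≤ℓ Q≤R i , distH , far

-- Assembly for a given real constant.

open import Defs
open import Data.Fin using (Fin)
open import Data.List.Membership.Propositional using (_∈_)
open import Data.Nat using (ℕ)
import Data.Nat as ℕ
open import Data.Product using (Σ-syntax; _×_; _,_)
open import Data.Rational using (ℚ; 0ℚ; _<_)
open import Relation.Nullary.Construct.Add.Supremum using (_⁺; [_])

module Witness (c₀ : ℝ) where
  import Data.Integer as ℤ
  import Data.Rational as ℚ
  open import Data.Product using (proj₁; proj₂)
  open import Data.Unit using (tt)
  open import Relation.Binary.PropositionalEquality using (sym; subst₂)

  q : ℚ
  q = proj₁ (ℝ.upperNonempty c₀)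

  c₀<q : ℝ.Upper c₀ q
  c₀<q = proj₂ (ℝ.upperNonempty c₀)

  abstract
    C : ℕ
    -- The absolute value of the numerator bounds `q` from above, and the successor ensures `1 ≤ C`.
    C = ℕ.suc ℤ.∣ ℚ.↥ q ∣

    q≤C : q ℚ.≤ fromℕ C
    q≤C = Rationals.≤-fromℕ q

    1≤C : 1 ℕ.≤ C
    1≤C = ℕ.s≤s ℕ.z≤n

  open Parametrisation.Family (Parametrisation.choice C 1≤C) hiding (1≤C) public

  lower : Σ[ a ∈ ℚ ] (0ℚ < a × (∀ k → a √ (A ℕ.* (k ℕ.* k)) ≤ (B ℕ.* k)))
  lower = Rationals.√-lower A 1≤A 1≤B

  upper : Σ[ b ∈ ℚ ] (0ℚ < b × (∀ k → (B ℕ.* k) ≤ b √ (A ℕ.* (k ℕ.* k))))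
  upper = Rationals.√-upper B 1≤A 1≤B

  module At (N : ℕ) where
    open Member N public

    P : DemandSet order
    P = demands (ℕ.s≤s ℕ.z≤n)

    P-lower : proj₁ lower √ order ≤ ∣ P ∣
    P-lower = subst₂ (proj₁ lower √_≤_) (sym order≡) (sym ∣demands∣≡) (proj₂ (proj₂ lower) X)

    P-upper : ∣ P ∣ ≤ proj₁ upper √ order
    P-upper = subst₂ (_≤ proj₁ upper √_) (sym ∣demands∣≡) (sym order≡) (proj₂ (proj₂ upper) X)

  far⇒+≤∞ : ∀ {n d e} {H : Graph n} {s t : Fin n} →
    Dist H s t e → (∀ {k} → Walk H s t k → d ℕ.+ C ℕ.≤ k) → d + c₀ ≤∞ e
  far⇒+≤∞ (disconnected _) far = tt
  far⇒+≤∞ (connected p _)  far = Rationals.+≤⇒+≤∞ c₀ C c₀<q q≤C (far p)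

theorem6 : Σ[ c* ∈ ℚ ] ((c₀ : ℝ) → c* ≤ᴿ c₀ →
    Σ[ a ∈ ℚ ] Σ[ b ∈ ℚ ] (0ℚ < a × 0ℚ < b ×
    ((N : ℕ) → Σ[ n ∈ ℕ ] (N ℕ.< n ×
    Σ[ G ∈ Graph n ] Σ[ P ∈ DemandSet n ]
    ((a √ n ≤ ∣ P ∣) × (∣ P ∣ ≤ b √ n) ×
    ((H : Graph n) → H ⊆ᴳ G → edgeCount H ≤ c₀ · n →
    Σ[ s ∈ Fin n ] Σ[ t ∈ Fin n ] ((s , t) ∈ DemandSet.pairs P ×
    Σ[ dG ∈ ℕ ] Σ[ dH ∈ ℕ ⁺ ]
    (Dist G s t [ dG ] × Dist H s t dH × dG + c₀ ≤∞ dH))))))))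
-- The threshold can be 0 because the construction runs with a natural number `C` ≥ 1 above `c₀`.
theorem6 = 0ℚ , λ c₀ _ →
  proj₁ (lower c₀) , proj₁ (upper c₀) , proj₁ (proj₂ (lower c₀)) , proj₁ (proj₂ (upper c₀)) , λ N →
  At.order c₀ N , At.N<order c₀ N , At.graph c₀ N , At.P c₀ N , At.P-lower c₀ N , At.P-upper c₀ N ,
  λ H H⊆G sparse →
  let s , t , st∈P , d , e , distG , distH , far =
        At.distorted c₀ N H H⊆G (Rationals.≤·⇒≤* c₀ (C c₀) (c₀<q c₀) (q≤C c₀) sparse)
  in s , t , st∈P , d , e , distG , distH , far⇒+≤∞ c₀ distH far
  where
  open Witness
  open import Data.Product using (proj₁; proj₂)
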